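{- Let $c\in\mathbb{N}$ and let $G$ be a graph. If the $\mathcal{R}_c$-treewidth of $G$ equals $k$, then $\mathrm{rw}(G)\le c+k+1$.
   Context: All graphs are finite, simple and undirected. $\mathrm{rw}(G)$ denotes the rank-width of $G$ and $\mathcal{R}_c$ is the class of graphs of rank-width at most $c$. Rank-width: for a bipartition $(U,W)$ of $V(G)$, the cut-rank $\rho_G(U)$ is the rank over $\mathrm{GF}(2)$ of the $U\times W$ submatrix of the adjacency matrix of $G$. A rank-decomposition of $G$ is a pair $(T,\mu)$ where $T$ is a tree of maximum degree 3 and $\mu$ is a bijection from $V(G)$ to the leaves of $T$; its width is the maximum over edges $e$ of $T$ of $\rho_G(\mu^{ -1}(A))$, where $(A,B)$ is the bipartition of the leaves of $T$ induced by $T-e$. The rank-width of $G$ is the minimum width of a rank-decomposition of $G$. Collapsing: for $X\subseteq V(G)$, $G\circ X$ is obtained from $G$ by deleting $X$ and adding an edge between $u,v\in V(G)\setminus X$ whenever $uv\notin E(G)$ and there is a $u$-$v$ path in $G$ with all internal vertices in $X$. $G\circ X$ is an $\mathcal{R}_c$-torso of $G$ if each connected component of $G[X]$ (as an induced subgraph) belongs to $\mathcal{R}_c$. The $\mathcal{R}_c$-treewidth of $G$ is the minimum treewidth of an $\mathcal{R}_c$-torso of $G$. -}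

module Defs where

open import Data.Bool.Base using (Bool; false; T; _∧_; _xor_; if_then_else_)
import Data.Bool.Properties as Bool
open import Data.Fin.Base using (Fin)
import Data.Fin.Properties as Fin
open import Data.Fin.Subset using
  (Subset; inside; outside; _∈_; _∉_; _⊆_; _∩_; _∪_; _─_; _-_; ⁅_⁆; ∣_∣; Nonempty)
open import Data.Fin.Subset.Properties using
  (_∈?_; _⊆?_; nonempty?; anySubset?; p─q⊆p; p─x─y≡p─y─x; x∈p∧x≢y⇒x∈p-y; x∈p⇒∣p-x∣<∣p∣;
   x∈p∩q⁺; ∪-comm; x∈p∧x∉q⇒x∈p─q)
open import Data.Integer.Base as ℤ using (ℤ; +_; 1ℤ)
open import Data.Nat.Base using (ℕ; zero; suc; _≤_; _⊔_; s≤s⁻¹)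
open import Data.Nat.Properties using (≤-refl; ≤-trans; n≮0)
open import Data.Product.Base using (∃; ∃₂; Σ; _×_; _,_; proj₁; proj₂)
open import Data.Sum.Base using (_⊎_; inj₁; inj₂)
open import Data.Vec.Base using ([]; _∷_; there; lookup; tabulate)
open import Data.Vec.Functional using (foldr)
open import Data.Vec.Properties.WithK using ([]=-irrelevant)
open import Function.Base using (_∘_)
open import Function.Bundles using (_⤖_; module Bijection)
open import Relation.Binary.PropositionalEquality using
  (_≡_; _≢_; refl; sym; subst)
open import Relation.Nullary.Decidable using
  (Dec; yes; no; ⌊_⌋; toWitness; fromWitness; map′; ¬?; T?;
   _×-dec_; _⊎-dec_; _→-dec_)
open import Relation.Nullary.Negation using (¬_; contradiction)

private
  variable
    m n : ℕ

------------------------------------------------------------------------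
-- Finite sets

⟦_⟧ : {P : Fin n → Set} → (∀ i → Dec (P i)) → Subset n
⟦ P? ⟧ = tabulate (λ i → ⌊ P? i ⌋)

-- The maximum of f over S, with the maximum over the empty set being 0.
maxOver : Subset n → (Fin n → ℕ) → ℕ
maxOver S f = foldr _⊔_ 0 (λ i → if lookup S i then f i else 0)

maxSubset : (Subset n → ℕ) → ℕ
maxSubset {zero}  f = f []
maxSubset {suc n} f = maxSubset (f ∘ (inside ∷_)) ⊔ maxSubset (f ∘ (outside ∷_))

------------------------------------------------------------------------
-- Minima of sets of integers

IsMinimum : (ℤ → Set) → ℤ → Set
IsMinimum P k = P k × (∀ {j} → P j → k ℤ.≤ j)

-- Where P has a minimum, that minimum is at most b.
MinimumAtMost : (ℤ → Set) → ℤ → Set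
MinimumAtMost P b = ∃ λ j → P j × j ℤ.≤ b

------------------------------------------------------------------------
-- Graphs

-- The vertex set is a subset of Fin n rather than the whole of it, so that
-- subgraphs of G and the graphs G ∘ X keep the names of the vertices of G.
record Graph (n : ℕ) : Set where
  field
    V       : Subset n
    adj     : Fin n → Fin n → Bool

  infix 4 _~_
  _~_ : Fin n → Fin n → Set
  u ~ v = T (adj u v)

  field
    ~-sym    : ∀ {u v} → u ~ v → v ~ u
    ~-irrefl : ∀ {u} → ¬ (u ~ u)
    ~⇒∈      : ∀ {u v} → u ~ v → u ∈ V

  N : Fin n → Subset n
  N u = tabulate (adj u)

  degree : Fin n → ℕ
  degree u = ∣ N u ∣

  Vertex : Set
  Vertex = ∃ λ v → v ∈ V

open Graph public using (V; adj; N; degree; Vertex)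

fromRelation : (V : Subset n) {E : Fin n → Fin n → Set} (E? : ∀ u v → Dec (E u v)) →
               (∀ {u v} → E u v → E v u) → (∀ {u} → ¬ E u u) →
               (∀ {u v} → E u v → u ∈ V) → Graph n
fromRelation V E? E-sym E-irrefl E⇒∈ = record
  { V        = V
  ; adj      = λ u v → ⌊ E? u v ⌋
  ; ~-sym    = λ {u} {v} e → fromWitness {a? = E? v u} (E-sym (toWitness {a? = E? u v} e))
  ; ~-irrefl = λ {u} e → E-irrefl (toWitness {a? = E? u u} e)
  ; ~⇒∈      = λ {u} {v} e → E⇒∈ (toWitness {a? = E? u v} e)
  }

infix 8 _[_]

_[_] : Graph n → Subset n → Graph n
G [ S ] = fromRelation (V G ∩ S)
  {λ u v → u ∈ S × v ∈ S × u ~ v}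
  (λ u v → (u ∈? S) ×-dec (v ∈? S) ×-dec T? (adj G u v))
  (λ (u∈S , v∈S , e) → v∈S , u∈S , ~-sym e)
  (λ (_ , _ , e) → ~-irrefl e)
  (λ (u∈S , _ , e) → x∈p∩q⁺ (~⇒∈ e , u∈S))
  where open Graph G using (_~_; ~-sym; ~-irrefl; ~⇒∈)

deleteEdge : Graph n → Fin n → Fin n → Graph n
deleteEdge G a b = fromRelation (V G)
  {λ u v → u ~ v × ¬ ((u ≡ a × v ≡ b) ⊎ (u ≡ b × v ≡ a))}
  (λ u v → T? (adj G u v) ×-dec
    ¬? ((u Fin.≟ a ×-dec v Fin.≟ b) ⊎-dec (u Fin.≟ b ×-dec v Fin.≟ a)))
  (λ (e , ≢ab) → ~-sym e ,
    λ { (inj₁ (v≡a , u≡b)) → ≢ab (inj₂ (u≡b , v≡a))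
      ; (inj₂ (v≡b , u≡a)) → ≢ab (inj₁ (u≡a , v≡b)) })
  (λ (e , _) → ~-irrefl e)
  (λ (e , _) → ~⇒∈ e)
  where open Graph G using (_~_; ~-sym; ~-irrefl; ~⇒∈)

------------------------------------------------------------------------
-- Paths

-- Path G S u v: the paths of G from u to v all of whose vertices lie in S.
-- Each vertex is removed from S when the path leaves it, so it cannot recur.
data Path (G : Graph n) : Subset n → Fin n → Fin n → Set where
  stop : ∀ {S u} → u ∈ S → Path G S u u
  step : ∀ {S u w v} → u ∈ S → Graph._~_ G u w → Path G (S - u) w v → Path G S u v

length : ∀ {G : Graph n} {S u v} → Path G S u v → ℕ
length (stop _)     = 0
length (step _ _ p) = suc (length p)

module _ (G : Graph n) where
  open Graph G using (_~_; ~-sym; ~-irrefl; ~⇒∈)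

  path? : ∀ S u v → Dec (Path G S u v)
  path? S = go ∣ S ∣ S ≤-refl
    where
    go : ∀ k S → ∣ S ∣ ≤ k → ∀ u v → Dec (Path G S u v)
    go k S ∣S∣≤k u v with u ∈? S
    ... | no u∉S = no λ { (stop u∈S) → u∉S u∈S ; (step u∈S _ _) → u∉S u∈S }
    go zero    S ∣S∣≤k u v | yes u∈S =
      contradiction (≤-trans (x∈p⇒∣p-x∣<∣p∣ u∈S) ∣S∣≤k) n≮0
    go (suc k) S ∣S∣≤k u v | yes u∈S = map′
      (λ { (inj₁ refl) → stop u∈S ; (inj₂ (_ , e , p)) → step u∈S e p })
      (λ { (stop _) → inj₁ refl ; (step _ e p) → inj₂ (_ , e , p) })
      ((u Fin.≟ v) ⊎-dec Fin.any? (λ w → T? (adj G u w) ×-dec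
        go k (S - u) (s≤s⁻¹ (≤-trans (x∈p⇒∣p-x∣<∣p∣ u∈S) ∣S∣≤k)) w v))

  private
    x∉p-x : ∀ {k} (p : Subset k) {x} → x ∉ p - x
    x∉p-x (_ ∷ _) {Fin.zero}  ()
    x∉p-x (_ ∷ p) {Fin.suc x} (there x∈p-x) = x∉p-x p x∈p-x

    snoc : ∀ {S R u v w} → R ≡ S - w → w ∈ S → Path G R u v → v ~ w → Path G S u w
    snoc {S} {w = w} refl w∈S (stop u∈S-w) e =
      step (p─q⊆p S ⁅ w ⁆ u∈S-w) e
        (stop (x∈p∧x≢y⇒x∈p-y w∈S λ { refl → ~-irrefl e }))
    snoc {S} {w = w} refl w∈S (step {u = u} u∈S-w e′ p) e with w Fin.≟ u
    ... | yes refl = contradiction u∈S-w (x∉p-x S)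
    ... | no w≢u   = step (p─q⊆p S ⁅ w ⁆ u∈S-w) e′
      (snoc (p─x─y≡p─y─x S w u) (x∈p∧x≢y⇒x∈p-y w∈S w≢u) p e)

  reverse : ∀ {S u v} → Path G S u v → Path G S v u
  reverse (stop u∈S)     = stop u∈S
  reverse (step u∈S e p) = snoc refl u∈S (reverse p) (~-sym e)

  component : Fin n → Subset n
  component u = ⟦ path? (V G) u ⟧

  -- The graph without vertices counts as connected.
  Connected : Set
  Connected = ∀ {u v} → u ∈ V G → v ∈ V G → Path G (V G) u v

  -- A cycle is a path with at least two edges together with an edge joining
  -- its ends.
  Cycle : Set
  Cycle = ∃₂ λ u v → Σ (Path G (V G) u v) λ p → 2 ≤ length p × v ~ u

  -- The graph without vertices is a tree, and so has a rank-decomposition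
  -- (of width 0) itself.
  IsTree : Set
  IsTree = Connected × ¬ Cycle

------------------------------------------------------------------------
-- Rank over GF(2), that is, over Bool with _xor_ and _∧_

sum₂ : (Fin n → Bool) → Bool
sum₂ = foldr _xor_ false

-- The rows in S of M, restricted to the columns in W, are linearly
-- independent: no sum over a nonempty R ⊆ S of these rows vanishes on W.
Independent : (Fin m → Fin n → Bool) → Subset n → Subset m → Set
Independent M W S =
  ¬ ∃ λ R → R ⊆ S × Nonempty R ×
      (∀ j → j ∈ W → sum₂ (λ i → lookup R i ∧ M i j) ≡ false)

independent? : (M : Fin m → Fin n → Bool) (W : Subset n) (S : Subset m) →
               Dec (Independent M W S)
independent? M W S = ¬? (anySubset? λ R →
  (R ⊆? S) ×-dec nonempty? R ×-dec
  Fin.all? (λ j → (j ∈? W) →-dec (sum₂ (λ i → lookup R i ∧ M i j) Bool.≟ false)))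

-- The rank of the U × W submatrix of M.
rank : (Fin m → Fin n → Bool) → Subset m → Subset n → ℕ
rank M U W = maxSubset λ S →
  if ⌊ (S ⊆? U) ×-dec independent? M W S ⌋ then ∣ S ∣ else 0

------------------------------------------------------------------------
-- Rank-width

cutRank : Graph n → Subset n → ℕ
cutRank G U = rank (adj G) U (V G ─ U)

-- The vertex of a one-vertex tree is a leaf, so that one-vertex graphs have a
-- rank-decomposition (of width 0).
Leaf : Graph n → Set
Leaf G = ∃ λ t → t ∈ V G × degree G t ≤ 1

preimage : (G : Graph n) → (Vertex G → Fin m) → Subset m → Subset n
preimage G f A = ⟦ (λ v → member? v (v ∈? V G)) ⟧
  where
  member? : ∀ v → Dec (v ∈ V G) → Dec (∃ λ v∈V → f (v , v∈V) ∈ A)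
  member? v (no v∉V)  = no λ (v∈V , _) → v∉V v∈V
  member? v (yes v∈V) = map′ (v∈V ,_)
    (λ (v∈V′ , ∈A) → subst (λ x → f (v , x) ∈ A) ([]=-irrelevant v∈V′ v∈V) ∈A)
    (f (v , v∈V) ∈? A)

record RankDecomposition (G : Graph n) : Set where
  field
    {size}    : ℕ
    tree      : Graph size
    isTree    : IsTree tree
    maxDegree : ∀ {t} → t ∈ V tree → degree tree t ≤ 3
    μ         : Vertex G ⤖ Leaf tree

  -- The vertices of G whose leaves are on the side of a in tree − ab.
  side : Fin size → Fin size → Subset n
  side a b = preimage G (proj₁ ∘ Bijection.to μ) (component (deleteEdge tree a b) a)

  -- Each edge occurs in both directions; its two sides have equal cut-rank.
  width : ℕ
  width = maxOver (V tree) λ a → maxOver (N tree a) λ b → cutRank G (side a b)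

infix 4 rw[_]≤_

rw[_]≤_ : Graph n → ℤ → Set
rw[ G ]≤ b = MinimumAtMost
  (λ w → ∃ λ (D : RankDecomposition G) → + RankDecomposition.width D ≡ w) b

-- The class 𝓡_c
𝓡 : ℕ → Graph n → Set
𝓡 c G = rw[ G ]≤ + c

------------------------------------------------------------------------
-- Treewidth

record TreeDecomposition (G : Graph n) : Set where
  open Graph G using (_~_)
  field
    {size}      : ℕ
    tree        : Graph size
    isTree      : IsTree tree
    bag         : Fin size → Subset n
    bag⊆V       : ∀ {t} → t ∈ V tree → bag t ⊆ V G
    coversV     : ∀ {v} → v ∈ V G → ∃ λ t → t ∈ V tree × v ∈ bag t
    coversE     : ∀ {u v} → u ~ v → ∃ λ t → t ∈ V tree × u ∈ bag t × v ∈ bag t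
    connected   : ∀ {v} → v ∈ V G → Connected (tree [ ⟦ (λ t → v ∈? bag t) ⟧ ])

  -- An integer, as a graph without vertices has treewidth −1.
  width : ℤ
  width = + maxOver (V tree) (λ t → ∣ bag t ∣) ℤ.- 1ℤ

Treewidth : Graph n → ℤ → Set
Treewidth G = IsMinimum λ w → ∃ λ (D : TreeDecomposition G) → TreeDecomposition.width D ≡ w

------------------------------------------------------------------------
-- Torsos

infixl 7 _⊚_

-- The graph G ∘ X.  As u and v are not in X, a path from u to v has all its
-- internal vertices in X just if all its vertices are in X ∪ {u, v}.
_⊚_ : Graph n → Subset n → Graph n
G ⊚ X = fromRelation (V G ─ X)
  {λ u v → u ∉ X × v ∉ X × (u ~ v ⊎ (u ≢ v × Path G (X ∪ (⁅ u ⁆ ∪ ⁅ v ⁆)) u v))}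
  (λ u v → ¬? (u ∈? X) ×-dec ¬? (v ∈? X) ×-dec
    (T? (adj G u v) ⊎-dec (¬? (u Fin.≟ v) ×-dec path? G _ u v)))
  (λ { (u∉X , v∉X , inj₁ e)         → v∉X , u∉X , inj₁ (~-sym e)
     ; {u} {v} (u∉X , v∉X , inj₂ (u≢v , p)) → v∉X , u∉X , inj₂
         ( u≢v ∘ sym
         , subst (λ S → Path G (X ∪ S) v u) (∪-comm ⁅ u ⁆ ⁅ v ⁆) (reverse G p)) })
  (λ { (_ , _ , inj₁ e) → ~-irrefl e ; (_ , _ , inj₂ (u≢u , _)) → u≢u refl })
  (λ { (u∉X , _ , inj₁ e)                      → x∈p∧x∉q⇒x∈p─q (~⇒∈ e) u∉X
     ; (u∉X , _ , inj₂ (u≢u , stop _))         → contradiction refl u≢u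
     ; (u∉X , _ , inj₂ (_ , step _ e _))       → x∈p∧x∉q⇒x∈p─q (~⇒∈ e) u∉X })
  where open Graph G using (_~_; ~-sym; ~-irrefl; ~⇒∈)

-- X ⊆ V(G) and G ∘ X is an 𝓡_c-torso of G.
IsTorso : ℕ → Graph n → Subset n → Set
IsTorso c G X = X ⊆ V G × (∀ {u} → u ∈ X → 𝓡 c (G [ X ] [ component (G [ X ]) u ]))

𝓡-Treewidth : ℕ → Graph n → ℤ → Set
𝓡-Treewidth c G = IsMinimum λ w → ∃ λ X → IsTorso c G X × Treewidth (G ⊚ X) w

{-# OPTIONS --safe #-}
module Submission where

-- Write cuts of G as binary trees whose nodes carry vertex sets (Cuts); these are equivalent to
-- rank-decompositions. Let X give an 𝓡_c-torso with a tree decomposition of width k. The neighbours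
-- of a component C of G[X] form a clique of G ∘ X, so some bag contains them all, and C is placed
-- at the node t of that bag; a vertex not in X is placed at a node whose bag contains it. Cut at
-- the tree decomposition as at a rooted tree: for a node t, every edge of G between different
-- pieces at t (branches of the tree, components, single vertices) has an end in the bag of t, so
-- a cut into unions of pieces has rank at most k + 1. Inside a component C continue with its own
-- rank-decomposition, whose cuts gain at most the k + 1 rows or columns of the neighbours of C.

open import Defs
open import Algebra.Bundles using (CommutativeRing)
import Algebra.Properties.CommutativeSemigroup as CommutativeSemigroupProperties
open import Data.Bool.Base using (Bool; true; false; _∧_; _xor_; if_then_else_)
import Data.Bool.Base as Bool using (T)
import Data.Bool.Properties as Bool
open import Data.Empty using (⊥-elim)
open import Data.Fin.Base using (Fin; zero; suc; splitAt; _↑ˡ_; _↑ʳ_)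
import Data.Fin.Properties as Fin
open import Data.Fin.Subset using
  (Subset; inside; outside; _∈_; _∉_; _⊆_; _∩_; _∪_; _─_; _-_; ⁅_⁆; ∣_∣; Nonempty; Empty; ⊥; ⊤)
open import Data.Fin.Subset.Properties
open import Data.Integer.Base using (ℤ; +_; _+_; 1ℤ)
import Data.Integer.Base as ℤ
import Data.Integer.Properties as ℤ
open import Data.Nat.Base using (ℕ; zero; suc; _≤_; _<_; z≤n; s≤s; s≤s⁻¹)
import Data.Nat.Base as ℕ
open import Data.Nat.Induction using (<-wellFounded)
open import Data.Nat.Properties hiding (_≟_)
open import Data.Product.Base using (∃; _×_; _,_; proj₁; proj₂)
open import Data.Sum.Base using (_⊎_; inj₁; inj₂; [_,_]′; swap)
open import Data.Vec.Base using ([]; _∷_; here; there; lookup; zipWith)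
open import Data.Vec.Properties using (lookup⇒[]=; []=⇒lookup; lookup∘tabulate; lookup-zipWith)
open import Data.Vec.Properties.WithK using ([]=-irrelevant)
open import Function.Base using (_∘_; id)
open import Function.Bundles using (module Bijection; module Equivalence; mk⇔; mk⤖)
open import Induction.WellFounded using (Acc; acc)
open import Relation.Binary.PropositionalEquality hiding ([_])
open import Relation.Nullary.Decidable using
  (Dec; yes; no; ⌊_⌋; toWitness; fromWitness; map′; T?; _×-dec_; _⊎-dec_; _→-dec_)
open import Relation.Nullary.Negation using (¬_; contradiction)

-- The bound is `c` + `K`, where `K` = `k` + 1 is the largest bag size. A set S meeting every edge
-- across a cut bounds its rank by the size of S: each removed row or column lowers the rank by at
-- most one, and a zero matrix remains. No cut pays for two bags: a cut between pieces at a node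
-- pays for the bag of that node alone, and only a cut inside a component pays `c` besides, its
-- neighbours lying in one bag. The bag of t separates the pieces at t because an edge of G missing
-- that bag either stays in one component of G[X] or has an end outside X, and the bags containing
-- such an end, being connected and avoiding t, lie in one branch at t. Joining many pieces two at a
-- time creates intermediate unions whose ranks need bounds too. A rank bound does not pass to
-- unions, but being covered by S does, so covers are what the recursion carries. With `Cuts`,
-- joining two decompositions is a constructor rather than surgery on trees of degree at most 3.

private
  variable
    m n : ℕ
    A B : Subset n
    P Q : Subset n → Set

-- Subsets, sums over GF(2) and ranks

T⇒≡true : ∀ {b} → Bool.T b → b ≡ true
T⇒≡true = Equivalence.to Bool.T-≡

≡true⇒T : ∀ {b} → b ≡ true → Bool.T b
≡true⇒T = Equivalence.from Bool.T-≡

∈⟦⟧⁺ : {P : Fin n → Set} (P? : ∀ i → Dec (P i)) → ∀ {i} → P i → i ∈ ⟦ P? ⟧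
∈⟦⟧⁺ P? {i} p =
  lookup⇒[]= i _ (trans (lookup∘tabulate _ i) (T⇒≡true (fromWitness {a? = P? i} p)))

∈⟦⟧⁻ : {P : Fin n → Set} (P? : ∀ i → Dec (P i)) → ∀ {i} → i ∈ ⟦ P? ⟧ → P i
∈⟦⟧⁻ P? {i} i∈ =
  toWitness {a? = P? i} (≡true⇒T (trans (sym (lookup∘tabulate _ i)) ([]=⇒lookup i∈)))

∈N⁺ : (G : Graph n) → ∀ {u v} → Bool.T (adj G u v) → v ∈ N G u
∈N⁺ G {u} {v} e = lookup⇒[]= v _ (trans (lookup∘tabulate _ v) (T⇒≡true e))

∈N⁻ : (G : Graph n) → ∀ {u v} → v ∈ N G u → Bool.T (adj G u v)
∈N⁻ G {u} {v} v∈ = ≡true⇒T (trans (sym (lookup∘tabulate _ v)) ([]=⇒lookup v∈))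

x∈p─q⇒x∉q : ∀ {n} {x : Fin n} (p q : Subset n) → x ∈ p ─ q → x ∉ q
x∈p─q⇒x∉q {x = zero}  (_ ∷ _) (inside ∷ _) ()         here
x∈p─q⇒x∉q {x = suc _} (_ ∷ p) (_ ∷ q)      (there x∈) (there x∈q) = x∈p─q⇒x∉q p q x∈ x∈q

x∈p─q⁻ : ∀ {x} (p q : Subset n) → x ∈ p ─ q → x ∈ p × x ∉ q
x∈p─q⁻ p q x∈ = p─q⊆p p q x∈ , x∈p─q⇒x∉q p q x∈

x∈p─p─q⇒x∈q : ∀ {x} (p q : Subset n) → x ∈ p ─ (p ─ q) → x ∈ q
x∈p─p─q⇒x∈q {x = x} p q x∈ with x∈p , x∉p─q ← x∈p─q⁻ p (p ─ q) x∈ with x ∈? q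
... | yes x∈q = x∈q
... | no x∉q  = contradiction (x∈p∧x∉q⇒x∈p─q x∈p x∉q) x∉p─q

Empty-─⇒⊆ : {p q : Subset n} → Empty (p ─ q) → p ⊆ q
Empty-─⇒⊆ {q = q} p─q≡∅ {x} x∈p with x ∈? q
... | yes x∈q = x∈q
... | no x∉q  = contradiction (x , x∈p∧x∉q⇒x∈p─q x∈p x∉q) p─q≡∅

x∈p-y⁻ : ∀ {x y} (p : Subset n) → x ∈ p - y → x ∈ p × x ≢ y
x∈p-y⁻ {y = y} p x∈ =
  p─q⊆p p _ x∈ , λ { refl → x∈p─q⇒x∉q p _ x∈ (x∈⁅x⁆ y) }

x∉p-x : ∀ {x} (p : Subset n) → x ∉ p - x
x∉p-x p x∈ = proj₂ (x∈p-y⁻ p x∈) refl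

-‿mono : ∀ {p q : Subset n} x → p ⊆ q → p - x ⊆ q - x
-‿mono {p = p} x p⊆q y∈ with y∈p , y≢x ← x∈p-y⁻ p y∈ = x∈p∧x≢y⇒x∈p-y (p⊆q y∈p) y≢x

p-x∩q⊆p∩q-x : ∀ (p q : Subset n) x → (p - x) ∩ q ⊆ p ∩ q - x
p-x∩q⊆p∩q-x p q x y∈ with y∈p-x , y∈q ← x∈p∩q⁻ (p - x) q y∈ with y∈p , y≢x ← x∈p-y⁻ p y∈p-x =
  x∈p∧x≢y⇒x∈p-y (x∈p∩q⁺ (y∈p , y∈q)) y≢x

p-x─q⊆p─q : ∀ (p q : Subset n) x → p - x ─ q ⊆ p ─ q
p-x─q⊆p─q p q x y∈ with y∈p-x , y∉q ← x∈p─q⁻ (p - x) q y∈ = x∈p∧x∉q⇒x∈p─q (p─q⊆p p _ y∈p-x) y∉q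

∣p∣≤∣p─q∣+∣p∩q∣ : (p q : Subset n) → ∣ p ∣ ≤ ∣ p ─ q ∣ ℕ.+ ∣ p ∩ q ∣
∣p∣≤∣p─q∣+∣p∩q∣ []            []            = z≤n
∣p∣≤∣p─q∣+∣p∩q∣ (outside ∷ p) (inside  ∷ q) = ∣p∣≤∣p─q∣+∣p∩q∣ p q
∣p∣≤∣p─q∣+∣p∩q∣ (outside ∷ p) (outside ∷ q) = ∣p∣≤∣p─q∣+∣p∩q∣ p q
∣p∣≤∣p─q∣+∣p∩q∣ (inside  ∷ p) (outside ∷ q) = s≤s (∣p∣≤∣p─q∣+∣p∩q∣ p q)
∣p∣≤∣p─q∣+∣p∩q∣ (inside  ∷ p) (inside  ∷ q) =
  ≤-trans (s≤s (∣p∣≤∣p─q∣+∣p∩q∣ p q)) (≤-reflexive (sym (+-suc ∣ p ─ q ∣ ∣ p ∩ q ∣)))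

∣p∣≤1+∣p-x∣ : (p : Subset n) (x : Fin n) → ∣ p ∣ ≤ suc ∣ p - x ∣
∣p∣≤1+∣p-x∣ p x = begin
  ∣ p ∣                        ≤⟨ ∣p∣≤∣p─q∣+∣p∩q∣ p ⁅ x ⁆ ⟩
  ∣ p - x ∣ ℕ.+ ∣ p ∩ ⁅ x ⁆ ∣  ≤⟨ +-monoʳ-≤ ∣ p - x ∣ (∣p∩q∣≤∣q∣ p ⁅ x ⁆) ⟩
  ∣ p - x ∣ ℕ.+ ∣ ⁅ x ⁆ ∣      ≡⟨ cong (∣ p - x ∣ ℕ.+_) (∣⁅x⁆∣≡1 x) ⟩
  ∣ p - x ∣ ℕ.+ 1              ≡⟨ +-comm ∣ p - x ∣ 1 ⟩
  suc ∣ p - x ∣                ∎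
  where open ≤-Reasoning

∣p∪q∣≤∣p∣+∣q∣ : {p q : Subset n} → (∀ {x} → x ∈ p → x ∉ q) → ∣ p ∣ ℕ.+ ∣ q ∣ ≤ ∣ p ∪ q ∣
∣p∪q∣≤∣p∣+∣q∣ {p = []}          {[]}          _ = z≤n
∣p∪q∣≤∣p∣+∣q∣ {p = outside ∷ p} {outside ∷ q} d = ∣p∪q∣≤∣p∣+∣q∣ λ x y → d (there x) (there y)
∣p∪q∣≤∣p∣+∣q∣ {p = inside ∷ p}  {outside ∷ q} d = s≤s (∣p∪q∣≤∣p∣+∣q∣ λ x y → d (there x) (there y))
∣p∪q∣≤∣p∣+∣q∣ {p = inside ∷ p}  {inside ∷ q}  d = contradiction here (d here)
∣p∪q∣≤∣p∣+∣q∣ {p = outside ∷ p} {inside ∷ q}  d =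
  ≤-trans (≤-reflexive (+-suc ∣ p ∣ ∣ q ∣)) (s≤s (∣p∪q∣≤∣p∣+∣q∣ λ x y → d (there x) (there y)))

Empty⇒∣p∣≡0 : {p : Subset n} → Empty p → ∣ p ∣ ≡ 0
Empty⇒∣p∣≡0 {n} e = trans (cong ∣_∣ (Empty-unique e)) (∣⊥∣≡0 n)

subsingleton⇒∣p∣≤1 : (p : Subset n) → (∀ {x y} → x ∈ p → y ∈ p → x ≡ y) → ∣ p ∣ ≤ 1
subsingleton⇒∣p∣≤1 p same with nonempty? p
... | no p≡∅      = ≤-trans (≤-reflexive (Empty⇒∣p∣≡0 p≡∅)) z≤n
... | yes (x , x∈p) = ≤-trans
  (p⊆q⇒∣p∣≤∣q∣ λ y∈p → subst (_∈ ⁅ x ⁆) (same x∈p y∈p) (x∈⁅x⁆ x)) (≤-reflexive (∣⁅x⁆∣≡1 x))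

∣p∣≤1⇒x≡y : {p : Subset n} → ∣ p ∣ ≤ 1 → ∀ {x y} → x ∈ p → y ∈ p → x ≡ y
∣p∣≤1⇒x≡y {p = p} ∣p∣≤1 {x} {y} x∈p y∈p with x Fin.≟ y
... | yes x≡y = x≡y
... | no x≢y  = contradiction
  (≤-trans (x∈p⇒∣p-x∣<∣p∣ (x∈p∧x≢y⇒x∈p-y x∈p x≢y)) (s≤s⁻¹ (≤-trans (x∈p⇒∣p-x∣<∣p∣ y∈p) ∣p∣≤1)))
  n≮0

maxOver-≤ : ∀ (S : Subset n) {f b} → (∀ {i} → i ∈ S → f i ≤ b) → maxOver S f ≤ b
maxOver-≤ []            h = z≤n
maxOver-≤ (inside ∷ S)  h = ⊔-lub (h here) (maxOver-≤ S (h ∘ there))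
maxOver-≤ (outside ∷ S) h = maxOver-≤ S (h ∘ there)

≤-maxOver : ∀ {S : Subset n} f {i} → i ∈ S → f i ≤ maxOver S f
≤-maxOver {S = inside  ∷ S} f here       = m≤m⊔n _ _
≤-maxOver {S = inside  ∷ S} f (there i∈) = ≤-trans (≤-maxOver (f ∘ suc) i∈) (m≤n⊔m _ _)
≤-maxOver {S = outside ∷ S} f (there i∈) = ≤-maxOver (f ∘ suc) i∈

maxSubset-≤ : ∀ (f : Subset n → ℕ) {b} → (∀ S → f S ≤ b) → maxSubset f ≤ b
maxSubset-≤ {zero}  f h = h []
maxSubset-≤ {suc n} f h =
  ⊔-lub (maxSubset-≤ _ (h ∘ (inside ∷_))) (maxSubset-≤ _ (h ∘ (outside ∷_)))

≤-maxSubset : ∀ (f : Subset n → ℕ) S → f S ≤ maxSubset f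
≤-maxSubset f []            = ≤-refl
≤-maxSubset f (inside ∷ S)  = ≤-trans (≤-maxSubset (f ∘ (inside ∷_)) S) (m≤m⊔n _ _)
≤-maxSubset f (outside ∷ S) = ≤-trans (≤-maxSubset (f ∘ (outside ∷_)) S) (m≤n⊔m _ _)

sum₂-false : {f : Fin n → Bool} → (∀ i → f i ≡ false) → sum₂ f ≡ false
sum₂-false {zero}  h = refl
sum₂-false {suc n} h rewrite h zero = sum₂-false (h ∘ suc)

sum₂-cong : {f g : Fin n → Bool} → (∀ i → f i ≡ g i) → sum₂ f ≡ sum₂ g
sum₂-cong {zero}  h = refl
sum₂-cong {suc n} h = cong₂ _xor_ (h zero) (sum₂-cong (h ∘ suc))

open CommutativeSemigroupProperties (CommutativeRing.+-commutativeSemigroup Bool.xor-∧-commutativeRing)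
  using () renaming (interchange to xor-interchange)

sum₂-xor : {f g h : Fin n → Bool} → (∀ i → h i ≡ f i xor g i) → sum₂ h ≡ sum₂ f xor sum₂ g
sum₂-xor {zero}  h≡ = refl
sum₂-xor {suc n} {f} {g} h≡ = trans (cong₂ _xor_ (h≡ zero) (sum₂-xor (h≡ ∘ suc)))
  (xor-interchange (f zero) (g zero) _ _)

restrict-false : ∀ {R : Subset n} {i b} → (i ∈ R → ¬ Bool.T b) → lookup R i ∧ b ≡ false
restrict-false {R = R} {i} {b} h with lookup R i in eq | b
... | false | _     = refl
... | true  | false = refl
... | true  | true  = contradiction _ (h (lookup⇒[]= i R eq))

restrict-cong : ∀ {R : Subset n} {i b c} → (i ∈ R → b ≡ c) → lookup R i ∧ b ≡ lookup R i ∧ c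
restrict-cong {R = R} {i} h with lookup R i in eq
... | false = refl
... | true  = h (lookup⇒[]= i R eq)

rank-≤ : ∀ {M : Fin m → Fin n → Bool} {U W r} →
         (∀ S → S ⊆ U → Independent M W S → ∣ S ∣ ≤ r) → rank M U W ≤ r
rank-≤ {M = M} {U} {W} h = maxSubset-≤ _ go
  where
  go : ∀ S → (if ⌊ (S ⊆? U) ×-dec independent? M W S ⌋ then ∣ S ∣ else 0) ≤ _
  go S with (S ⊆? U) ×-dec independent? M W S
  ... | yes (S⊆U , ind) = h S S⊆U ind
  ... | no _            = z≤n

≤-rank : ∀ {M : Fin m → Fin n → Bool} {U W} S → S ⊆ U → Independent M W S → ∣ S ∣ ≤ rank M U W
≤-rank {M = M} {U} {W} S S⊆U ind = ≤-trans (go _) (≤-maxSubset _ S)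
  where
  go : (d : Dec (S ⊆ U × Independent M W S)) → ∣ S ∣ ≤ (if ⌊ d ⌋ then ∣ S ∣ else 0)
  go (yes _) = ≤-refl
  go (no ¬p) = ⊥-elim (¬p (S⊆U , ind))

-- Removing rows and columns from a matrix

module _ (M : Fin m → Fin n → Bool) where

  rowSum : Subset m → Fin n → Bool
  rowSum R j = sum₂ (λ i → lookup R i ∧ M i j)

  Independent-rows : ∀ {W S S′} → S′ ⊆ S → Independent M W S → Independent M W S′
  Independent-rows S′⊆S ind (R , R⊆S′ , ne , z) = ind (R , S′⊆S ∘ R⊆S′ , ne , z)

  Independent-columns : ∀ {W W′ S} → W ⊆ W′ → Independent M W S → Independent M W′ S
  Independent-columns W⊆W′ ind (R , R⊆S , ne , z) = ind (R , R⊆S , ne , λ j → z j ∘ W⊆W′)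

  -- If R is a dependency over W - c and r ∈ R, then a dependency R′ avoiding r has, like R, an
  -- odd sum in column c, and R ⊕ R′ is a dependency over W.
  remove-column : ∀ {W S} c → Independent M W S →
                  ∃ λ S′ → S′ ⊆ S × Independent M (W - c) S′ × ∣ S ∣ ≤ suc ∣ S′ ∣
  remove-column {W} {S} c ind with independent? M (W - c) S
  ... | yes ind′ = S , id , ind′ , n≤1+n _
  ... | no ¬ind with anySubset? (λ R → (R ⊆? S) ×-dec nonempty? R ×-dec
                     Fin.all? (λ j → (j ∈? (W - c)) →-dec (rowSum R j Bool.≟ false)))
  ...   | no ∄R = contradiction ∄R ¬ind
  ...   | yes (R , R⊆S , (r , r∈R) , R≡0) = S - r , p─q⊆p S _ , ind′ , ∣p∣≤1+∣p-x∣ S r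
    where
    -- A zero sum in column `c` as well would make `R′` a dependency over all of `W`.
    odd : ∀ R′ → R′ ⊆ S → Nonempty R′ → (∀ j → j ∈ W - c → rowSum R′ j ≡ false) →
          rowSum R′ c ≡ true
    odd R′ R′⊆S ne z with rowSum R′ c in eq
    ... | true  = refl
    ... | false = ⊥-elim (ind (R′ , R′⊆S , ne , z′))
      where
      z′ : ∀ j → j ∈ W → rowSum R′ j ≡ false
      z′ j j∈W with j Fin.≟ c
      ... | yes refl = eq
      ... | no j≢c   = z j (x∈p∧x≢y⇒x∈p-y j∈W j≢c)

    ind′ : Independent M (W - c) (S - r)
    ind′ (R′ , R′⊆S-r , ne , R′≡0) = contradiction (sym odd-sum) λ ()
      where
      open ≡-Reasoning
      R⊕R′ : Subset m
      R⊕R′ = zipWith _xor_ R R′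

      R⊕R′-sum : ∀ j → rowSum R⊕R′ j ≡ rowSum R j xor rowSum R′ j
      R⊕R′-sum j = sum₂-xor λ i → trans
        (cong (_∧ M i j) (lookup-zipWith _xor_ i R R′))
        (Bool.∧-distribʳ-xor (M i j) (lookup R i) (lookup R′ i))

      R⊕R′⊆S : R⊕R′ ⊆ S
      R⊕R′⊆S {i} i∈ with lookup R i in eq | lookup R′ i in eq′
      ... | true  | _     = R⊆S (lookup⇒[]= i R eq)
      ... | false | true  = p─q⊆p S _ (R′⊆S-r (lookup⇒[]= i R′ eq′))
      ... | false | false = contradiction
        (trans (sym ([]=⇒lookup i∈)) (trans (lookup-zipWith _xor_ i R R′) (cong₂ _xor_ eq eq′)))
        λ ()

      r∉R′ : lookup R′ r ≡ false
      r∉R′ = Bool.¬-not λ eq → x∉p-x S (R′⊆S-r (lookup⇒[]= r R′ eq))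

      r∈R⊕R′ : r ∈ R⊕R′
      r∈R⊕R′ = lookup⇒[]= r _
        (trans (lookup-zipWith _xor_ r R R′) (cong₂ _xor_ ([]=⇒lookup r∈R) r∉R′))

      odd-sum : true ≡ false
      odd-sum = begin
        true                        ≡⟨ odd R⊕R′ R⊕R′⊆S (r , r∈R⊕R′) (λ j j∈ →
                                         trans (R⊕R′-sum j) (cong₂ _xor_ (R≡0 j j∈) (R′≡0 j j∈))) ⟨
        rowSum R⊕R′ c               ≡⟨ R⊕R′-sum c ⟩
        rowSum R c xor rowSum R′ c  ≡⟨ cong₂ _xor_ (odd R R⊆S (r , r∈R) R≡0)
                                         (odd R′ (p─q⊆p S _ ∘ R′⊆S-r) ne R′≡0) ⟩
        false                       ∎

  -- Each removed column costs at most one row. `k` bounds the number of columns still to be removed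
  -- and is what the recursion decreases.
  remove-columns : ∀ B k W {S} → ∣ W ∩ B ∣ ≤ k → Independent M W S →
                   ∃ λ S′ → S′ ⊆ S × Independent M (W ─ B) S′ × ∣ S ∣ ≤ k ℕ.+ ∣ S′ ∣
  remove-columns B k W {S} ∣W∩B∣≤k ind with nonempty? (W ∩ B)
  ... | no W∩B≡∅ = S , id ,
    Independent-columns (λ x∈W → x∈p∧x∉q⇒x∈p─q x∈W λ x∈B → W∩B≡∅ (_ , x∈p∩q⁺ (x∈W , x∈B))) ind ,
    m≤n+m ∣ S ∣ k
  remove-columns B zero W ∣W∩B∣≤k ind | yes (c , c∈) =
    contradiction (≤-trans (x∈p⇒∣p-x∣<∣p∣ c∈) ∣W∩B∣≤k) n≮0
  remove-columns B (suc k) W ∣W∩B∣≤k ind | yes (c , c∈)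
    with S₁ , S₁⊆S , ind₁ , ∣S∣≤ ← remove-column c ind
    with S₂ , S₂⊆S₁ , ind₂ , ∣S₁∣≤ ← remove-columns B k (W - c)
      (s≤s⁻¹ (≤-trans (s≤s (p⊆q⇒∣p∣≤∣q∣ (p-x∩q⊆p∩q-x W B c))) (≤-trans (x∈p⇒∣p-x∣<∣p∣ c∈) ∣W∩B∣≤k))) ind₁
    = S₂ , S₁⊆S ∘ S₂⊆S₁ , Independent-columns (p-x─q⊆p─q W B c) ind₂ , ≤-trans ∣S∣≤ (s≤s ∣S₁∣≤)

-- Rows in `B` are discarded and columns in `B` cost one row each; as `U` and `W` are disjoint, the
-- two losses together are at most the size of `B`. What survives is supported on `U′` × `W′`. With
-- `U′` and `W′` empty this bounds a rank by a vertex cover; with `M′` the matrix of a subgraph it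
-- compares cut-ranks in the two graphs.
rank-cover : ∀ {n} (M M′ : Fin n → Fin n → Bool) {U W U′ W′ : Subset n} (B : Subset n) →
             (∀ {x} → x ∈ U → x ∉ W) →
             (∀ {i j} → i ∈ U → j ∈ W → i ∉ B → j ∉ B → Bool.T (M i j) → i ∈ U′ × j ∈ W′) →
             (∀ {i j} → i ∈ U′ → j ∈ W′ → M i j ≡ M′ i j) →
             rank M U W ≤ rank M′ U′ W′ ℕ.+ ∣ B ∣
rank-cover {n} M M′ {U} {W} {U′} {W′} B U∩W≡∅ cover M≡M′ = rank-≤ bound
  where
  bound : ∀ S → S ⊆ U → Independent M W S → ∣ S ∣ ≤ rank M′ U′ W′ ℕ.+ ∣ B ∣
  bound S S⊆U ind
    with S′ , S′⊆S─B , ind′ , ∣S─B∣≤ ←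
      remove-columns M B ∣ W ∩ B ∣ W ≤-refl (Independent-rows M (p─q⊆p S B) ind) = begin
    ∣ S ∣                                 ≤⟨ ∣p∣≤∣p─q∣+∣p∩q∣ S B ⟩
    ∣ S ─ B ∣ ℕ.+ ∣ S ∩ B ∣               ≤⟨ +-monoˡ-≤ ∣ S ∩ B ∣ ∣S─B∣≤ ⟩
    ∣ W ∩ B ∣ ℕ.+ ∣ S′ ∣ ℕ.+ ∣ S ∩ B ∣    ≡⟨ cong (ℕ._+ ∣ S ∩ B ∣) (+-comm ∣ W ∩ B ∣ ∣ S′ ∣) ⟩
    ∣ S′ ∣ ℕ.+ ∣ W ∩ B ∣ ℕ.+ ∣ S ∩ B ∣    ≡⟨ +-assoc ∣ S′ ∣ _ _ ⟩
    ∣ S′ ∣ ℕ.+ (∣ W ∩ B ∣ ℕ.+ ∣ S ∩ B ∣)  ≤⟨ +-mono-≤ (≤-rank S′ S′⊆U′ ind″) B-parts ⟩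
    rank M′ U′ W′ ℕ.+ ∣ B ∣               ∎
    where
    open ≤-Reasoning

    B-parts : ∣ W ∩ B ∣ ℕ.+ ∣ S ∩ B ∣ ≤ ∣ B ∣
    B-parts = ≤-trans
      (∣p∪q∣≤∣p∣+∣q∣ λ x∈W∩B x∈S∩B → U∩W≡∅ (S⊆U (p∩q⊆p S B x∈S∩B)) (p∩q⊆p W B x∈W∩B))
      (p⊆q⇒∣p∣≤∣q∣ λ x∈ → case-∪ (x∈p∪q⁻ (W ∩ B) (S ∩ B) x∈))
      where
      case-∪ : ∀ {x} → x ∈ W ∩ B ⊎ x ∈ S ∩ B → x ∈ B
      case-∪ (inj₁ x∈) = p∩q⊆q W B x∈
      case-∪ (inj₂ x∈) = p∩q⊆q S B x∈

    cover′ : ∀ {i j} → i ∈ S′ → j ∈ W ─ B → Bool.T (M i j) → i ∈ U′ × j ∈ W′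
    cover′ i∈S′ j∈ with i∈S , i∉B ← x∈p─q⁻ S B (S′⊆S─B i∈S′) | j∈W , j∉B ← x∈p─q⁻ W B j∈ =
      cover (S⊆U i∈S) j∈W i∉B j∉B

    -- A row outside `U′` vanishes on `W ─ B`, so alone it would be a dependency.
    S′⊆U′ : S′ ⊆ U′
    S′⊆U′ {i} i∈S′ with i ∈? U′
    ... | yes i∈U′ = i∈U′
    ... | no i∉U′  = ⊥-elim (ind′ (⁅ i ⁆ , ⁅i⁆⊆S′ , (i , x∈⁅x⁆ i) , row≡0))
      where
      ⁅i⁆⊆S′ : ⁅ i ⁆ ⊆ S′
      ⁅i⁆⊆S′ k∈ with refl ← x∈⁅y⁆⇒x≡y i k∈ = i∈S′
      row≡0 : ∀ j → j ∈ W ─ B → rowSum M ⁅ i ⁆ j ≡ false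
      row≡0 j j∈ = sum₂-false {n} λ k → restrict-false λ k∈ e →
        i∉U′ (subst (_∈ U′) (x∈⁅y⁆⇒x≡y i k∈) (proj₁ (cover′ (⁅i⁆⊆S′ k∈) j∈ e)))

    -- Columns outside `W′` vanish on the rows of `S′`, so a dependency over `W′` is one over
    -- `W ─ B`.
    ind″ : Independent M′ W′ S′
    ind″ (R , R⊆S′ , ne , z) = ind′ (R , R⊆S′ , ne , z′)
      where
      z′ : ∀ j → j ∈ W ─ B → rowSum M R j ≡ false
      z′ j j∈ with j ∈? W′
      ... | yes j∈W′ = trans
        (sum₂-cong {n} λ i → restrict-cong {R = R} λ i∈R → M≡M′ (S′⊆U′ (R⊆S′ i∈R)) j∈W′) (z j j∈W′)
      ... | no j∉W′  = sum₂-false {n} λ i → restrict-false {R = R} λ i∈R e →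
        j∉W′ (proj₂ (cover′ (R⊆S′ i∈R) j∈ e))

-- Paths and branches of trees

Path-source : ∀ {G : Graph n} {S u v} → Path G S u v → u ∈ S
Path-source (stop u∈S)     = u∈S
Path-source (step u∈S _ _) = u∈S

Path-map : ∀ {G H : Graph n} {S S′ u v} → S ⊆ S′ →
           (∀ {x y} → x ∈ S → y ∈ S → Graph._~_ G x y → Graph._~_ H x y) →
           Path G S u v → Path H S′ u v
Path-map S⊆S′ f (stop u∈S) = stop (S⊆S′ u∈S)
Path-map {S = S} S⊆S′ f (step {u = u} u∈S e p) =
  step (S⊆S′ u∈S) (f u∈S (p─q⊆p S _ (Path-source p)) e)
    (Path-map (-‿mono u S⊆S′) (λ x∈ y∈ → f (p─q⊆p S _ x∈) (p─q⊆p S _ y∈)) p)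

module _ {G : Graph n} where
  open Graph G using (_~_; ~-sym; ~-irrefl; ~⇒∈)

  Path-mono : ∀ {S S′ u v} → S ⊆ S′ → Path G S u v → Path G S′ u v
  Path-mono S⊆S′ = Path-map S⊆S′ λ _ _ → id

  Path-target : ∀ {S u v} → Path G S u v → v ∈ S
  Path-target         (stop u∈S)   = u∈S
  Path-target {S} (step _ _ p) = p─q⊆p S _ (Path-target p)

  -- A path that visits `x` is cut off there. `Path-suffix` keeps the other half instead.
  Path-avoid : ∀ {S u v} x → Path G S u v → Path G S u x ⊎ Path G (S - x) u v
  Path-avoid {S} {u} x p with u Fin.≟ x
  ... | yes refl = inj₁ (stop (Path-source p))
  Path-avoid x (stop u∈S) | no u≢x = inj₂ (stop (x∈p∧x≢y⇒x∈p-y u∈S u≢x))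
  Path-avoid {S} {u} x (step u∈S e p) | no u≢x with Path-avoid x p
  ... | inj₁ q = inj₁ (step u∈S e q)
  ... | inj₂ q = inj₂ (step (x∈p∧x≢y⇒x∈p-y u∈S u≢x) e
    (subst (λ R → Path G R _ _) (p─x─y≡p─y─x S u x) q))

  Path-suffix : ∀ {S u v} x → Path G S u v → Path G S x v ⊎ Path G (S - x) u v
  Path-suffix {S} {u} x p with u Fin.≟ x
  ... | yes refl = inj₁ p
  Path-suffix x (stop u∈S) | no u≢x = inj₂ (stop (x∈p∧x≢y⇒x∈p-y u∈S u≢x))
  Path-suffix {S} {u} x (step u∈S e p) | no u≢x with Path-suffix x p
  ... | inj₁ q = inj₁ (Path-mono (p─q⊆p S _) q)
  ... | inj₂ q = inj₂ (step (x∈p∧x≢y⇒x∈p-y u∈S u≢x) e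
    (subst (λ R → Path G R _ _) (p─x─y≡p─y─x S u x) q))

  -- Paths repeat no vertex, so concatenation has to skip loops: if the second path returns to the
  -- start `u` of the first, its part from `u` on is already the result.
  Path-trans : ∀ {S u v w} → Path G S u v → Path G S v w → Path G S u w
  Path-trans (stop _) q = q
  Path-trans {u = u} (step u∈S e p) q with Path-suffix u q
  ... | inj₁ q′ = q′
  ... | inj₂ q′ = step u∈S e (Path-trans p q′)

  Path-snoc : ∀ {S u v w} → Path G S u v → v ~ w → w ∈ S → Path G S u w
  Path-snoc {v = v} {w} p e w∈S = Path-trans p
    (step (Path-target p) e (stop (x∈p∧x≢y⇒x∈p-y w∈S λ { refl → ~-irrefl e })))

-- branch T a p is the side of a in the tree T − ap.
opaque
  branch : Graph m → Fin m → Fin m → Subset m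
  branch T a p = ⟦ path? T (V T - p) a ⟧

  branch⁺ : ∀ {T : Graph m} {a p t} → Path T (V T - p) a t → t ∈ branch T a p
  branch⁺ {T = T} {a} {p} = ∈⟦⟧⁺ (path? T (V T - p) a)

  branch⁻ : ∀ {T : Graph m} {a p t} → t ∈ branch T a p → Path T (V T - p) a t
  branch⁻ {T = T} {a} {p} = ∈⟦⟧⁻ (path? T (V T - p) a)

module _ {T : Graph m} where
  open Graph T using (_~_; ~-sym; ~-irrefl; ~⇒∈)

  ~⇒≢ : ∀ {a b} → a ~ b → a ≢ b
  ~⇒≢ e refl = ~-irrefl e

  p∉branch : ∀ {a p} → p ∉ branch T a p
  p∉branch p∈ = x∉p-x (V T) (Path-target (branch⁻ p∈))

  a∈branch : ∀ {a p} → a ~ p → a ∈ branch T a p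
  a∈branch e = branch⁺ (stop (x∈p∧x≢y⇒x∈p-y (~⇒∈ e) (~⇒≢ e)))

  branch-trans : ∀ {a p t t′} → t ∈ branch T a p → Path T (V T - p) t t′ → t′ ∈ branch T a p
  branch-trans t∈ q = branch⁺ (Path-trans (branch⁻ t∈) q)

  branch-unfold : ∀ {a p t} → t ∈ branch T a p →
                  t ≡ a ⊎ ∃ λ b → a ~ b × b ≢ p × t ∈ branch T b a
  branch-unfold t∈ with branch⁻ t∈
  ... | stop _ = inj₁ refl
  ... | step {u = a} a∈ e q = inj₂ (_ , e ,
    proj₂ (x∈p-y⁻ (V T) (p─q⊆p (V T - _) _ (Path-source q))) ,
    branch⁺ (Path-mono (-‿mono a (p─q⊆p (V T) _)) q))

  module _ (isTree : IsTree T) where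

    -- Going from `a` to `b`, along the path to `p` and back to `a` would be a cycle. Matching on
    -- the path makes its length of at least 2 visible.
    acyclic : ∀ {a b p} → a ~ b → a ~ p → b ≢ p → ¬ Path T (V T - a) b p
    acyclic a~b a~p b≢p (stop _) = b≢p refl
    acyclic a~b a~p b≢p q@(step _ _ _) =
      proj₂ isTree (_ , _ , step (~⇒∈ a~b) a~b q , s≤s (s≤s z≤n) , ~-sym a~p)

    -- The converse of `branch-unfold`. A path from `b` that avoids `a` also avoids `p`, by
    -- `acyclic`, so it can be prolonged by `a`.
    branch-fold : ∀ {a b p t} → a ~ p → a ~ b → b ≢ p → t ∈ branch T b a → t ∈ branch T a p
    branch-fold {a} {b} {p} a~p a~b b≢p t∈ with Path-avoid p (branch⁻ t∈)
    ... | inj₁ q = contradiction q (acyclic a~b a~p b≢p)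
    ... | inj₂ q = branch⁺ (step (x∈p∧x≢y⇒x∈p-y (~⇒∈ a~b) (~⇒≢ a~p)) a~b
      (subst (λ R → Path T R _ _) (p─x─y≡p─y─x (V T) a p) q))

    branch-unique : ∀ {a b b′ t} → a ~ b → a ~ b′ → t ∈ branch T b a → t ∈ branch T b′ a → b ≡ b′
    branch-unique {b = b} {b′} a~b a~b′ t∈ t∈′ with b Fin.≟ b′
    ... | yes b≡b′ = b≡b′
    ... | no b≢b′  = contradiction
      (Path-trans (branch⁻ t∈) (reverse T (branch⁻ t∈′))) (acyclic a~b a~b′ b≢b′)

    root-cover : ∀ {r t} → r ∈ V T → t ∈ V T → t ≡ r ⊎ ∃ λ b → r ~ b × t ∈ branch T b r
    root-cover r∈V t∈V with proj₁ isTree r∈V t∈V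
    ... | stop _       = inj₁ refl
    ... | step _ r~b q = inj₂ (_ , r~b , branch⁺ q)

    branch-cover : ∀ {a p t} → a ~ p → t ∈ V T → t ∈ branch T a p ⊎ t ∈ branch T p a
    branch-cover {a} {p} a~p t∈V with root-cover (~⇒∈ a~p) t∈V
    ... | inj₁ refl = inj₁ (a∈branch a~p)
    ... | inj₂ (b , a~b , t∈) with b Fin.≟ p
    ...   | yes refl = inj₂ t∈
    ...   | no b≢p   = inj₁ (branch-fold a~p a~b b≢p t∈)

    branch-disjoint : ∀ {a p t} → a ~ p → t ∈ branch T a p → t ∉ branch T p a
    branch-disjoint a~p t∈ t∈′ with branch-unfold t∈
    ... | inj₁ refl                = p∉branch t∈′
    ... | inj₂ (b , a~b , b≢p , t∈b) = b≢p (branch-unique a~b a~p t∈b t∈′)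

    -- Recursion on the tree as if rooted on the side of `p`, with directed edges in place of a
    -- fixed root. It terminates because the branch at a child `b` lies inside the branch at `a` and
    -- misses `a`.
    branch-induction : (P : Fin m → Fin m → Set) →
                       (∀ {a p} → a ~ p → (∀ {b} → a ~ b → b ≢ p → P b a) → P a p) →
                       ∀ {a p} → a ~ p → P a p
    branch-induction P h e = go e (<-wellFounded _)
      where
      go : ∀ {a p} → a ~ p → Acc _<_ ∣ branch T a p ∣ → P a p
      go {a} a~p (acc rec) = h a~p λ a~b b≢p → go (~-sym a~b)
        (rec (p⊂q⇒∣p∣<∣q∣ (branch-fold a~p a~b b≢p , a , a∈branch a~p , p∉branch)))

    -- In a tree, deleting the edge or the vertex `b` leaves the same side of `a`: reaching `b` from
    -- `a` without the edge would close a cycle. This turns the sides in the definition of width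
    -- into branches.
    component≡branch : ∀ {a b} → a ~ b → component (deleteEdge T a b) a ≡ branch T a b
    component≡branch {a} {b} a~b = ⊆-antisym to from
      where
      to : component (deleteEdge T a b) a ⊆ branch T a b
      to t∈ with Path-avoid b (∈⟦⟧⁻ (path? (deleteEdge T a b) (V T) a) t∈)
      ... | inj₁ (stop _) = contradiction a~b ~-irrefl
      ... | inj₁ (step {w = w} _ e q) = ⊥-elim
        (acyclic (proj₁ e′) a~b (λ w≡b → proj₂ e′ (inj₁ (refl , w≡b))) (Path-map id (λ _ _ → forget) q))
        where
        edge : ∀ {x y} → Graph._~_ (deleteEdge T a b) x y →
               x ~ y × ¬ ((x ≡ a × y ≡ b) ⊎ (x ≡ b × y ≡ a))
        edge = toWitness
        forget : ∀ {x y} → Graph._~_ (deleteEdge T a b) x y → x ~ y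
        forget = proj₁ ∘ edge
        e′ = edge e
      ... | inj₂ q = branch⁺ (Path-map id (λ _ _ → proj₁ ∘ toWitness) q)

      from : branch T a b ⊆ component (deleteEdge T a b) a
      from t∈ = ∈⟦⟧⁺ (path? (deleteEdge T a b) (V T) a)
        (Path-map (p─q⊆p (V T) _) (λ x∈ y∈ e → fromWitness (e , λ
          { (inj₁ (_ , y≡b)) → proj₂ (x∈p-y⁻ (V T) y∈) y≡b
          ; (inj₂ (x≡b , _)) → proj₂ (x∈p-y⁻ (V T) x∈) x≡b })) (branch⁻ t∈))

-- Cuts from rank-decompositions

record Split (P : Subset n → Set) (A B : Subset n) : Set where
  constructor _,_
  field
    disjoint : ∀ {x} → x ∈ A → x ∉ B
    holds    : P (A ∪ B)

-- The rooted binary trees with leaf set A such that P holds of the leaf set of every subtree.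
data Cuts (P : Subset n → Set) : Subset n → Set where
  leaf : ∀ {v} → P ⁅ v ⁆ → Cuts P ⁅ v ⁆
  node : ∀ {A B} → Split P A B → Cuts P A → Cuts P B → Cuts P (A ∪ B)

Cuts-map : ∀ {A} → (∀ {B} → B ⊆ A → P B → Q B) → Cuts P A → Cuts Q A
Cuts-map f (leaf p)       = leaf (f id p)
Cuts-map f (node {A} {B} (d , p) l r) = node (d , f id p)
  (Cuts-map (λ ⊆A → f (p⊆p∪q B ∘ ⊆A)) l) (Cuts-map (λ ⊆B → f (q⊆p∪q A B ∘ ⊆B)) r)

-- `Cuts` has no empty tree, yet a node of a tree decomposition may have no vertex placed at it or
-- in a branch beyond it.
Cuts∅ : (Subset n → Set) → Subset n → Set
Cuts∅ P A = Empty A ⊎ Cuts P A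

join : (∀ {x} → x ∈ A → x ∉ B) → P (A ∪ B) → Cuts∅ P A → Cuts∅ P B → Cuts∅ P (A ∪ B)
join d p (inj₂ l) (inj₂ r) = inj₂ (node (d , p) l r)
join {A = A} {B = B} {P = P} d p (inj₁ A≡∅) r =
  subst (Cuts∅ P) (⊆-antisym (q⊆p∪q A B) λ x∈ → case-∪ (x∈p∪q⁻ A B x∈)) r
  where
  case-∪ : ∀ {x} → x ∈ A ⊎ x ∈ B → x ∈ B
  case-∪ (inj₁ x∈A) = ⊥-elim (A≡∅ (_ , x∈A))
  case-∪ (inj₂ x∈B) = x∈B
join {A = A} {B = B} {P = P} d p l@(inj₂ _) (inj₁ B≡∅) =
  subst (Cuts∅ P) (⊆-antisym (p⊆p∪q B) λ x∈ → case-∪ (x∈p∪q⁻ A B x∈)) l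
  where
  case-∪ : ∀ {x} → x ∈ A ⊎ x ∈ B → x ∈ A
  case-∪ (inj₁ x∈A) = x∈A
  case-∪ (inj₂ x∈B) = ⊥-elim (B≡∅ (_ , x∈B))

Cuts∅-nonempty : ∀ {x} → x ∈ A → Cuts∅ P A → Cuts P A
Cuts∅-nonempty x∈A (inj₁ A≡∅) = ⊥-elim (A≡∅ (_ , x∈A))
Cuts∅-nonempty x∈A (inj₂ t)   = t

-- Bounding both directions of a cut makes the symmetry of the rank superfluous.
record BoundedCut (G : Graph n) (w : ℕ) (A : Subset n) : Set where
  constructor _,_
  field
    inner : cutRank G A ≤ w
    outer : cutRank G (V G ─ A) ≤ w

module _ (G : Graph n) where
  open Graph G using (_~_; ~-sym; ~⇒∈)

  -- G may be any graph containing H as an induced subgraph.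
  cutRank-extend : (H : Graph n) → (∀ {x y} → x ∈ V H → y ∈ V H → adj G x y ≡ adj H x y) →
                   ∀ {S w} → (∀ {x y} → x ∈ V H → x ~ y → y ∈ V H ⊎ y ∈ S) →
                   ∀ {A} → A ⊆ V H → BoundedCut H w A → BoundedCut G (w ℕ.+ ∣ S ∣) A
  cutRank-extend H adj≡ {S} {w} nbr {A} A⊆H (ρ , ρ′) =
    ≤-trans (rank-cover (adj G) (adj H) S (λ x∈A x∈ → x∈p─q⇒x∉q (V G) A x∈ x∈A)
      (λ {i} {j} i∈A j∈ _ j∉S e → i∈A , outer j∈ j∉S i∈A e)
      (λ i∈A j∈ → adj≡ (A⊆H i∈A) (p─q⊆p (V H) A j∈)))
      (+-monoˡ-≤ ∣ S ∣ ρ) ,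
    ≤-trans (rank-cover (adj G) (adj H) S (λ x∈ x∈′ → x∈p─q⇒x∉q (V G) (V G ─ A) x∈′ x∈)
      (λ {i} {j} i∈ j∈ i∉S _ e → let j∈A = x∈p─p─q⇒x∈q (V G) A j∈ in
        outer i∈ i∉S j∈A (~-sym e) ,
        x∈p∧x∉q⇒x∈p─q (A⊆H j∈A) λ j∈H─A → x∈p─q⇒x∉q (V H) A j∈H─A j∈A)
      (λ i∈ j∈ → adj≡ (p─q⊆p (V H) A i∈) (p─q⊆p (V H) _ j∈)))
      (+-monoˡ-≤ ∣ S ∣ ρ′)
    where
    outer : ∀ {x y} → y ∈ V G ─ A → y ∉ S → x ∈ A → x ~ y → y ∈ V H ─ A
    outer y∈ y∉S x∈A e with nbr (A⊆H x∈A) e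
    ... | inj₁ y∈H = x∈p∧x∉q⇒x∈p─q y∈H (x∈p─q⇒x∉q (V G) A y∈)
    ... | inj₂ y∈S = contradiction y∈S y∉S

  -- `S` is a vertex cover of the bipartite graph formed by the edges that leave `A`.
  Covers : Subset n → Subset n → Set
  Covers S A = ∀ {x y} → x ∈ A → y ∉ A → x ~ y → x ∈ S ⊎ y ∈ S

  -- Outside the rows and columns of `S` the cut matrix is zero, so `rank-cover` applies with the
  -- empty matrix.
  cutRank-cover : ∀ {S A} → Covers S A → BoundedCut G ∣ S ∣ A
  cutRank-cover {S} {A} cov =
    bound (λ x∈A x∈ → x∈p─q⇒x∉q (V G) A x∈ x∈A)
      (λ i∈A j∈ i∉S j∉S e → uncovered i∉S j∉S (cov i∈A (x∈p─q⇒x∉q (V G) A j∈) e)) ,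
    bound (λ x∈ x∈′ → x∈p─q⇒x∉q (V G) (V G ─ A) x∈′ x∈)
      (λ i∈ j∈ i∉S j∉S e → uncovered j∉S i∉S
        (cov (x∈p─p─q⇒x∈q (V G) A j∈) (x∈p─q⇒x∉q (V G) A i∈) (~-sym e)))
    where
    uncovered : ∀ {i j} → i ∉ S → j ∉ S → ¬ (i ∈ S ⊎ j ∈ S)
    uncovered i∉S j∉S (inj₁ i∈S) = i∉S i∈S
    uncovered i∉S j∉S (inj₂ j∈S) = j∉S j∈S

    bound : ∀ {U W} → (∀ {x} → x ∈ U → x ∉ W) →
            (∀ {i j} → i ∈ U → j ∈ W → i ∉ S → j ∉ S → ¬ (i ~ j)) → rank (adj G) U W ≤ ∣ S ∣
    bound disj no-edge = ≤-trans
      (rank-cover (adj G) (adj G) {U′ = ⊥} {⊥} S disj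
        (λ i∈ j∈ i∉S j∉S e → ⊥-elim (no-edge i∈ j∈ i∉S j∉S e)) λ _ _ → refl)
      (+-monoˡ-≤ ∣ S ∣ (rank-≤ {M = adj G} {⊥} {⊥} λ R R⊆⊥ _ →
        ≤-trans (p⊆q⇒∣p∣≤∣q∣ R⊆⊥) (≤-reflexive (∣⊥∣≡0 n))))

  BoundedCut-V : ∀ {w} → BoundedCut G w (V G)
  BoundedCut-V {w} with ρ , ρ′ ← cutRank-cover {⊥} {V G} (λ _ y∉V e → contradiction (~⇒∈ (~-sym e)) y∉V) =
    ≤-trans ρ ⊥≤w , ≤-trans ρ′ ⊥≤w
    where
    ⊥≤w : ∣ ⊥ {n} ∣ ≤ w
    ⊥≤w = ≤-trans (≤-reflexive (∣⊥∣≡0 n)) z≤n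

  module _ {f : Vertex G → Fin m} where
    preimage⁻ : ∀ {A v} → v ∈ preimage G f A → ∃ λ v∈V → f (v , v∈V) ∈ A
    preimage⁻ = ∈⟦⟧⁻ {P = λ v → ∃ λ v∈V → f (v , v∈V) ∈ _} _

    preimage⁺ : ∀ {A v} v∈V → f (v , v∈V) ∈ A → v ∈ preimage G f A
    preimage⁺ v∈V f∈A = ∈⟦⟧⁺ {P = λ v → ∃ λ v∈V → f (v , v∈V) ∈ _} _ (v∈V , f∈A)

Leaf-≡ : {T : Graph m} {s t : Leaf T} → proj₁ s ≡ proj₁ t → s ≡ t
Leaf-≡ {s = t , t∈ , d} {.t , t∈′ , d′} refl =
  cong (t ,_) (cong₂ _,_ ([]=-irrelevant t∈ t∈′) (≤-irrelevant d d′))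

module _ {G : Graph n} (D : RankDecomposition G) where
  open RankDecomposition D renaming (tree to T)
  open Graph T using (_~_; ~-sym; ~-irrefl; ~⇒∈)

  private
    leafOf : Vertex G → Fin size
    leafOf = proj₁ ∘ Bijection.to μ

    leafOf∈T : ∀ v → leafOf v ∈ V T
    leafOf∈T = proj₁ ∘ proj₂ ∘ Bijection.to μ

    pre : Subset size → Subset n
    pre = preimage G leafOf

    opaque
      below : Fin size → Fin size → Subset n
      below a p = pre (branch T a p)

      below≡ : ∀ {a p} → pre (branch T a p) ≡ below a p
      below≡ = refl

      below⁺ : ∀ {a p v} v∈V → leafOf (v , v∈V) ∈ branch T a p → v ∈ below a p
      below⁺ = preimage⁺ G

      below⁻ : ∀ {a p v} → v ∈ below a p → ∃ λ v∈V → leafOf (v , v∈V) ∈ branch T a p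
      below⁻ = preimage⁻ G

    side≡below : ∀ {a p} → a ~ p → side a p ≡ below a p
    side≡below a~p = trans (cong pre (component≡branch isTree a~p)) below≡

    cutRank-below : ∀ {a p} → a ~ p → cutRank G (below a p) ≤ width
    cutRank-below {a} {p} a~p = subst (λ A → cutRank G A ≤ width) (side≡below a~p)
      (≤-trans (≤-maxOver (λ b → cutRank G (side a b)) (∈N⁺ T a~p))
        (≤-maxOver (λ a → maxOver (N T a) λ b → cutRank G (side a b)) (~⇒∈ a~p)))

    complement : ∀ {a p} → a ~ p → below p a ≡ V G ─ below a p
    complement {a} {p} a~p = ⊆-antisym
      (λ v∈ → let v∈V , f∈ = below⁻ v∈ in
        x∈p∧x∉q⇒x∈p─q v∈V λ v∈′ → let v∈V′ , f∈′ = below⁻ v∈′ in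
          branch-disjoint isTree a~p f∈′
            (subst (λ z → leafOf (_ , z) ∈ _) ([]=-irrelevant v∈V v∈V′) f∈))
      (λ v∈ → let v∈V , v∉ = x∈p─q⁻ (V G) (below a p) v∈ in
        from v∈V v∉ (branch-cover isTree a~p (leafOf∈T (_ , v∈V))))
      where
      from : ∀ {v} v∈V → v ∉ below a p →
             leafOf (v , v∈V) ∈ branch T a p ⊎ leafOf (v , v∈V) ∈ branch T p a → v ∈ below p a
      from v∈V v∉ (inj₁ f∈) = contradiction (below⁺ v∈V f∈) v∉
      from v∈V v∉ (inj₂ f∈) = below⁺ v∈V f∈

    -- Opaque to keep the width from being unfolded.
    opaque
      Good : Subset n → Set
      Good = BoundedCut G width

      Good⇒BoundedCut : ∀ {A} → Good A → BoundedCut G width A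
      Good⇒BoundedCut = id

      Good-V : Good (V G)
      Good-V = BoundedCut-V G

      Good-below : ∀ {a p} → a ~ p → Good (below a p)
      -- The width ranges over both directions of each edge; the reversed edge bounds the outer
      -- cut-rank.
      Good-below a~p = cutRank-below a~p ,
        subst (λ A → cutRank G A ≤ width) (complement a~p) (cutRank-below (~-sym a~p))

    below-disjoint : ∀ {a b b′ v} → a ~ b → a ~ b′ → v ∈ below b a → v ∈ below b′ a → b ≡ b′
    below-disjoint a~b a~b′ v∈ v∈′ with v∈V , f∈ ← below⁻ v∈ | v∈V′ , f∈′ ← below⁻ v∈′ =
      branch-unique isTree a~b a~b′ f∈
        (subst (λ z → leafOf (_ , z) ∈ _) ([]=-irrelevant v∈V′ v∈V) f∈′)

    below-fold : ∀ {a b p} → a ~ p → a ~ b → b ≢ p → below b a ⊆ below a p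
    below-fold a~p a~b b≢p v∈ with v∈V , f∈ ← below⁻ v∈ =
      below⁺ v∈V (branch-fold isTree a~p a~b b≢p f∈)

    child⁻ : ∀ {a b} S → S ⊆ N T a → ∀ {p} → b ∈ S - p → a ~ b × b ≢ p
    child⁻ S S⊆N b∈ with b∈S , b≢p ← x∈p-y⁻ S b∈ = ∈N⁻ T (S⊆N b∈S) , b≢p

    below-unfold : ∀ {a p v} → ¬ degree T a ≤ 1 → v ∈ below a p →
                   ∃ λ b → b ∈ N T a - p × v ∈ below b a
    below-unfold ¬leaf v∈ with v∈V , f∈ ← below⁻ v∈ with branch-unfold f∈
    ... | inj₁ refl = contradiction (proj₂ (proj₂ (Bijection.to μ (_ , v∈V)))) ¬leaf
    ... | inj₂ (b , a~b , b≢p , f∈b) =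
      b , x∈p∧x≢y⇒x∈p-y (∈N⁺ T a~b) b≢p , below⁺ v∈V f∈b

    -- The only neighbour of `a` is `p`, so the branch is `a` alone, and surjectivity of `μ`
    -- supplies the vertex of G at `a`.
    leaf-below : ∀ {a p} → a ~ p → degree T a ≤ 1 → Cuts∅ Good (below a p)
    leaf-below {a} {p} a~p deg≤1 with (v , v∈V) , hit ← Bijection.surjective μ (a , ~⇒∈ a~p , deg≤1) =
      inj₂ (subst (Cuts Good) (sym below≡v) (leaf (subst Good below≡v (Good-below a~p))))
      where
      v↦a : leafOf (v , v∈V) ≡ a
      v↦a = cong proj₁ (hit refl)

      only-a : ∀ {t} → t ∈ branch T a p → t ≡ a
      only-a t∈ with branch-unfold t∈
      ... | inj₁ t≡a = t≡a
      ... | inj₂ (b , a~b , b≢p , _) =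
        contradiction (∣p∣≤1⇒x≡y deg≤1 (∈N⁺ T a~b) (∈N⁺ T a~p)) b≢p

      below≡v : below a p ≡ ⁅ v ⁆
      below≡v = ⊆-antisym
        (λ {x} x∈ → let x∈V , f∈ = below⁻ x∈ in
          subst (_∈ ⁅ v ⁆) (sym (cong proj₁ (Bijection.injective μ {x , x∈V} {v , v∈V}
            (Leaf-≡ {T = T} (trans (only-a f∈) (sym v↦a)))))) (x∈⁅x⁆ v))
        (λ x∈ → subst (_∈ below a p) (sym (x∈⁅y⁆⇒x≡y v x∈))
          (below⁺ v∈V (subst (_∈ branch T a p) (sym v↦a) (a∈branch a~p))))

    internal-below : ∀ {a p} → a ~ p → ¬ degree T a ≤ 1 →
                     (∀ {b} → a ~ b → b ≢ p → Cuts∅ Good (below b a)) → Cuts∅ Good (below a p)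
    internal-below {a} {p} a~p ¬leaf ih with nonempty? (N T a - p)
    ... | no none = inj₁ λ (v , v∈) → let b , b∈ , _ = below-unfold ¬leaf v∈ in none (b , b∈)
    ... | yes (b , b∈) with a~b , b≢p ← child⁻ (N T a) id b∈
                       with nonempty? (N T a - p - b)
    -- A node of degree 2 only subdivides an edge and is suppressed.
    ...   | no one = subst (Cuts∅ Good) (⊆-antisym (below-fold a~p a~b b≢p) only-b) (ih a~b b≢p)
      where
      only-b : below a p ⊆ below b a
      only-b v∈ with c , c∈ , v∈c ← below-unfold ¬leaf v∈ with c Fin.≟ b
      ... | yes refl = v∈c
      ... | no c≢b   = contradiction (c , x∈p∧x≢y⇒x∈p-y c∈ c≢b) one
    ...   | yes (b′ , b′∈) with b′∈′ , b′≢b ← x∈p-y⁻ (N T a - p) b′∈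
                           with a~b′ , b′≢p ← child⁻ (N T a) (λ z → z) b′∈′
      = subst (Cuts∅ Good) union≡
          (join (λ v∈ v∈′ → b′≢b (sym (below-disjoint a~b a~b′ v∈ v∈′)))
            (subst Good (sym union≡) (Good-below a~p)) (ih a~b b≢p) (ih a~b′ b′≢p))
      where
      -- Of at most three neighbours, `p` and `b` are already accounted for, so `b′` is the last.
      ∣rest∣≤1 : ∣ N T a - p - b ∣ ≤ 1
      ∣rest∣≤1 = s≤s⁻¹ (≤-trans (x∈p⇒∣p-x∣<∣p∣ b∈)
        (s≤s⁻¹ (≤-trans (x∈p⇒∣p-x∣<∣p∣ (∈N⁺ T a~p)) (maxDegree (~⇒∈ a~p)))))

      union≡ : below b a ∪ below b′ a ≡ below a p
      union≡ = ⊆-antisym (λ v∈ → to (x∈p∪q⁻ _ _ v∈)) from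
        where
        to : ∀ {v} → v ∈ below b a ⊎ v ∈ below b′ a → v ∈ below a p
        to (inj₁ v∈) = below-fold a~p a~b b≢p v∈
        to (inj₂ v∈) = below-fold a~p a~b′ b′≢p v∈
        from : below a p ⊆ below b a ∪ below b′ a
        from v∈ with c , c∈ , v∈c ← below-unfold ¬leaf v∈ with c Fin.≟ b
        ... | yes refl = x∈p∪q⁺ (inj₁ v∈c)
        ... | no c≢b with refl ← ∣p∣≤1⇒x≡y ∣rest∣≤1 (x∈p∧x≢y⇒x∈p-y c∈ c≢b) b′∈ = x∈p∪q⁺ (inj₂ v∈c)

    cuts-below : ∀ {a p} → a ~ p → Cuts∅ Good (below a p)
    cuts-below = branch-induction isTree (λ a p → Cuts∅ Good (below a p)) step′
      where
      step′ : ∀ {a p} → a ~ p → (∀ {b} → a ~ b → b ≢ p → Cuts∅ Good (below b a)) →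
              Cuts∅ Good (below a p)
      step′ {a} a~p ih with degree T a ≤? 1
      ... | yes deg≤1 = leaf-below a~p deg≤1
      ... | no ¬leaf  = internal-below a~p ¬leaf ih

    -- The unrooted tree is rooted by subdividing an edge at the leaf of `u`. Without such an edge
    -- the tree is a single node and `u` is the only vertex.
    cuts-V : ∀ {u} → u ∈ V G → Cuts Good (V G)
    cuts-V {u} u∈V with nonempty? (N T (leafOf (u , u∈V)))
    ... | no isolated = subst (Cuts Good) (sym V≡u) (leaf (subst Good V≡u Good-V))
      where
      V≡u : V G ≡ ⁅ u ⁆
      V≡u = ⊆-antisym to (λ x∈ → subst (_∈ V G) (sym (x∈⁅y⁆⇒x≡y u x∈)) u∈V)
        where
        to : V G ⊆ ⁅ u ⁆
        to {x} x∈V with root-cover isTree (leafOf∈T (u , u∈V)) (leafOf∈T (x , x∈V))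
        ... | inj₁ same = subst (_∈ ⁅ u ⁆)
          (sym (cong proj₁ (Bijection.injective μ (Leaf-≡ {T = T} same)))) (x∈⁅x⁆ u)
        ... | inj₂ (b , e , _) = contradiction (b , ∈N⁺ T e) isolated
    ... | yes (b , b∈) = Cuts∅-nonempty u∈V (subst (Cuts∅ Good) union≡V
        (join (λ v∈ v∈′ → proj₂ (x∈p─q⁻ _ _ (subst (_ ∈_) (complement t~b) v∈′)) v∈)
          (subst Good (sym union≡V) Good-V) (cuts-below t~b) (cuts-below (~-sym t~b))))
      where
      t = leafOf (u , u∈V)
      t~b : t ~ b
      t~b = ∈N⁻ T b∈

      union≡V : below t b ∪ below b t ≡ V G
      union≡V = ⊆-antisym (λ v∈ → to (x∈p∪q⁻ _ _ v∈))
        (λ v∈V → x∈p∪q⁺ (from v∈V (branch-cover isTree t~b (leafOf∈T (_ , v∈V)))))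
        where
        to : ∀ {v} → v ∈ below t b ⊎ v ∈ below b t → v ∈ V G
        to (inj₁ v∈) = proj₁ (below⁻ v∈)
        to (inj₂ v∈) = proj₁ (below⁻ v∈)
        from : ∀ {v} v∈V → leafOf (v , v∈V) ∈ branch T t b ⊎ leafOf (v , v∈V) ∈ branch T b t →
               v ∈ below t b ⊎ v ∈ below b t
        from v∈V (inj₁ f∈) = inj₁ (below⁺ v∈V f∈)
        from v∈V (inj₂ f∈) = inj₂ (below⁺ v∈V f∈)

  rankDecomposition⇒cuts : ∀ {u} → u ∈ V G → Cuts (BoundedCut G width) (V G)
  rankDecomposition⇒cuts u∈V = Cuts-map (λ _ → Good⇒BoundedCut) (cuts-V u∈V)

-- Rank-decompositions from cuts

-- ab is the only edge of T leaving S, and a is its end in S.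
record Separates (T : Graph m) (S : Subset m) (a b : Fin m) : Set where
  field
    a∈S      : a ∈ S
    b∉S      : b ∉ S
    crossing : ∀ {x y} → x ∈ S → y ∉ S → Graph._~_ T x y → x ≡ a × y ≡ b

module _ {T : Graph m} where
  open Graph T using (_~_; ~-sym; ~-irrefl; ~⇒∈)

  Path-inside : ∀ {S a b R x t} → Separates T S a b → b ∉ R → Path T R x t → x ∈ S → t ∈ S
  Path-inside sep b∉R (stop _) x∈S = x∈S
  Path-inside {S} {R = R} sep b∉R (step {w = w} _ e q) x∈S with w ∈? S
  ... | yes w∈S = Path-inside sep (b∉R ∘ p─q⊆p R _) q w∈S
  ... | no w∉S with refl ← proj₂ (Separates.crossing sep x∈S w∉S e) =
    contradiction (p─q⊆p R _ (Path-source q)) b∉R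

  Path-outside : ∀ {S a b R x t} → Separates T S a b → a ∉ R → Path T R x t → x ∉ S → t ∉ S
  Path-outside sep a∉R (stop _) x∉S = x∉S
  Path-outside {S} {R = R} sep a∉R (step {w = w} _ e q) x∉S with w ∈? S
  ... | no w∉S  = Path-outside sep (a∉R ∘ p─q⊆p R _) q w∉S
  ... | yes w∈S with refl ← proj₁ (Separates.crossing sep w∈S x∉S (~-sym e)) =
    contradiction (p─q⊆p R _ (Path-source q)) a∉R

  loop-trivial : ∀ {S u} (p : Path T S u u) → length p ≡ 0
  loop-trivial (stop _) = refl
  loop-trivial {S} (step _ _ q) = contradiction (Path-target q) (x∉p-x S)

  -- The edge closing a cycle and the first edge of its path would both cross the same cut.
  bridges⇒acyclic : (∀ {a b} → a ~ b → ∃ λ S → Separates T S a b ⊎ Separates T S b a) → ¬ Cycle T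
  bridges⇒acyclic bridge (u , v , stop _ , () , _)
  bridges⇒acyclic bridge (u , v , step {w = w} _ u~w q , 2≤ , v~u) with v Fin.≟ w
  ... | yes refl = contradiction (subst (1 ≤_) (loop-trivial q) (s≤s⁻¹ 2≤)) n≮0
  ... | no v≢w with bridge u~w
  ...   | S , inj₁ sep = v≢w (proj₂ (Separates.crossing sep (Separates.a∈S sep)
    (Path-outside sep (x∉p-x (V T)) q (Separates.b∉S sep)) (~-sym v~u)))
  ...   | S , inj₂ sep = v≢w (proj₁ (Separates.crossing sep
    (Path-inside sep (x∉p-x (V T)) q (Separates.a∈S sep)) (Separates.b∉S sep) v~u))

  module _ (isTree : IsTree T) {S a b} (sep : Separates T S a b) (a~b : a ~ b) where
    branch-inside : ∀ {t} → t ∈ branch T a b → t ∈ S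
    branch-inside t∈ = Path-inside sep (x∉p-x (V T)) (branch⁻ t∈) (Separates.a∈S sep)

    branch-outside : ∀ {t} → t ∈ branch T b a → t ∉ S
    branch-outside t∈ = Path-outside sep (x∉p-x (V T)) (branch⁻ t∈) (Separates.b∉S sep)

    inside⇒branch : ∀ {t} → t ∈ V T → t ∈ S → t ∈ branch T a b
    inside⇒branch t∈V t∈S with branch-cover isTree a~b t∈V
    ... | inj₁ t∈ = t∈
    ... | inj₂ t∈ = contradiction t∈S (branch-outside t∈)

    outside⇒branch : ∀ {t} → t ∈ V T → t ∉ S → t ∈ branch T b a
    outside⇒branch t∈V t∉S with branch-cover isTree a~b t∈V
    ... | inj₁ t∈ = contradiction (branch-inside t∈) t∉S
    ... | inj₂ t∈ = t∈

-- Positions in a tree of cuts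

module _ {n : ℕ} {P : Subset n → Set} where

  private
    variable
      A₁ A₂ : Subset n
      t l   : Cuts P A₁
      r     : Cuts P A₂
      s     : Split P A₁ A₂

  data Node : ∀ {A} → Cuts P A → Set where
    here  : Node t
    left  : Node l → Node (node s l r)
    right : Node r → Node (node s l r)

  data Child : ∀ {A} {t : Cuts P A} → Node t → Node t → Set where
    hereˡ : Child {t = node s l r} here (left here)
    hereʳ : Child {t = node s l r} here (right here)
    left  : {x y : Node l} → Child x y → Child {t = node s l r} (left x) (left y)
    right : {x y : Node r} → Child x y → Child {t = node s l r} (right x) (right y)

  data Within : ∀ {A} {t : Cuts P A} → Node t → Node t → Set where
    here  : {x : Node t} → Within here x
    left  : {x y : Node l} → Within x y → Within {t = node s l r} (left x) (left y)
    right : {x y : Node r} → Within x y → Within {t = node s l r} (right x) (right y)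

  data IsLeaf : ∀ {A} {t : Cuts P A} → Node t → Fin n → Set where
    here  : ∀ {v p} → IsLeaf {t = leaf {v = v} p} here v
    left  : {x : Node l} {v : Fin n} → IsLeaf x v → IsLeaf {t = node s l r} (left x) v
    right : {x : Node r} {v : Fin n} → IsLeaf x v → IsLeaf {t = node s l r} (right x) v

  label : ∀ {A} {t : Cuts P A} → Node t → Subset n
  label {A} here = A
  label (left x)     = label x
  label (right x)    = label x

  label-P : (x : Node t) → P (label x)
  label-P {t = leaf p}       here = p
  label-P {t = node (_ , p) _ _} here = p
  label-P (left x)  = label-P x
  label-P (right x) = label-P x

  child? : (x y : Node t) → Dec (Child x y)
  child? here      here              = no λ ()
  child? here      (left here)       = yes hereˡ
  child? here      (left (left _))   = no λ ()
  child? here      (left (right _))  = no λ ()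
  child? here      (right here)      = yes hereʳ
  child? here      (right (left _))  = no λ ()
  child? here      (right (right _)) = no λ ()
  child? (left x)  here              = no λ ()
  child? (left x)  (left y)          = map′ left (λ { (left c) → c }) (child? x y)
  child? (left x)  (right y)         = no λ ()
  child? (right x) here              = no λ ()
  child? (right x) (left y)          = no λ ()
  child? (right x) (right y)         = map′ right (λ { (right c) → c }) (child? x y)

  within? : (x y : Node t) → Dec (Within x y)
  within? here      y         = yes here
  within? (left x)  here      = no λ ()
  within? (left x)  (left y)  = map′ left (λ { (left c) → c }) (within? x y)
  within? (left x)  (right y) = no λ ()
  within? (right x) here      = no λ ()
  within? (right x) (left y)  = no λ ()
  within? (right x) (right y) = map′ right (λ { (right c) → c }) (within? x y)

  child-irrefl : {x : Node t} → ¬ Child x x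
  child-irrefl (left c)  = child-irrefl c
  child-irrefl (right c) = child-irrefl c

  parent-unique : {x y z : Node t} → Child x z → Child y z → x ≡ y
  parent-unique hereˡ     hereˡ      = refl
  parent-unique hereʳ     hereʳ      = refl
  parent-unique (left c)  (left c′)  = cong left (parent-unique c c′)
  parent-unique (right c) (right c′) = cong right (parent-unique c c′)

  within-refl : (x : Node t) → Within x x
  within-refl here      = here
  within-refl (left x)  = left (within-refl x)
  within-refl (right x) = right (within-refl x)

  within-child : {q x y : Node t} → Within q x → Child x y → Within q y
  within-child here      c         = here
  within-child (left w)  (left c)  = left (within-child w c)
  within-child (right w) (right c) = right (within-child w c)

  within-parent : {q x y : Node t} → Within q x → Child y x → Within q y ⊎ x ≡ q
  within-parent here             c         = inj₁ here
  within-parent (left here)      hereˡ     = inj₂ refl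
  within-parent (right here)     hereʳ     = inj₂ refl
  within-parent (left w)  (left c) with within-parent w c
  ... | inj₁ w′   = inj₁ (left w′)
  ... | inj₂ refl = inj₂ refl
  within-parent (right w) (right c) with within-parent w c
  ... | inj₁ w′   = inj₁ (right w′)
  ... | inj₂ refl = inj₂ refl

  parent-not-within : {p q : Node t} → Child p q → ¬ Within q p
  parent-not-within (left c)  (left w)  = parent-not-within c w
  parent-not-within (right c) (right w) = parent-not-within c w

  label⊆ : {t : Cuts P A₁} (x : Node t) → label x ⊆ A₁
  label⊆ here      = id
  label⊆ (left x)  = p⊆p∪q _ ∘ label⊆ x
  label⊆ (right x) = q⊆p∪q _ _ ∘ label⊆ x

  leaf∈ : {t : Cuts P A₁} {x : Node t} {v : Fin n} → IsLeaf x v → v ∈ A₁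
  leaf∈ here      = x∈⁅x⁆ _
  leaf∈ (left l)  = p⊆p∪q _ (leaf∈ l)
  leaf∈ (right l) = q⊆p∪q _ _ (leaf∈ l)

  leafAt : (t : Cuts P A₁) {v : Fin n} → v ∈ A₁ → ∃ λ (x : Node t) → IsLeaf x v
  leafAt (leaf {v} _) v∈ with refl ← x∈⁅y⁆⇒x≡y v v∈ = here , here
  leafAt (node {A} {B} _ l r) v∈ with x∈p∪q⁻ A B v∈
  ... | inj₁ v∈A = let x , x-leaf = leafAt l v∈A in left x , left x-leaf
  ... | inj₂ v∈B = let x , x-leaf = leafAt r v∈B in right x , right x-leaf

  leaf-unique : {x y : Node t} {v : Fin n} → IsLeaf x v → IsLeaf y v → x ≡ y
  leaf-unique here      here       = refl
  leaf-unique (left l)  (left l′)  = cong left (leaf-unique l l′)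
  leaf-unique (right l) (right l′) = cong right (leaf-unique l l′)
  leaf-unique {t = node (d , _) _ _} (left l)  (right l′) = contradiction (leaf∈ l′) (d (leaf∈ l))
  leaf-unique {t = node (d , _) _ _} (right l) (left l′)  = contradiction (leaf∈ l) (d (leaf∈ l′))

  leaf-value : {x : Node t} {v w : Fin n} → IsLeaf x v → IsLeaf x w → v ≡ w
  leaf-value here      here       = refl
  leaf-value (left l)  (left l′)  = leaf-value l l′
  leaf-value (right l) (right l′) = leaf-value l l′

  leaf-childless : {x y : Node t} {v : Fin n} → IsLeaf x v → ¬ Child x y
  leaf-childless (left l)  (left c)  = leaf-childless l c
  leaf-childless (right l) (right c) = leaf-childless l c

  within⇒∈label : {q x : Node t} {v : Fin n} → Within q x → IsLeaf x v → v ∈ label q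
  within⇒∈label here      l         = leaf∈ l
  within⇒∈label (left w)  (left l)  = within⇒∈label w l
  within⇒∈label (right w) (right l) = within⇒∈label w l

  ∈label⇒within : (q : Node t) {v : Fin n} → v ∈ label q →
                  ∃ λ x → Within q x × IsLeaf x v
  ∈label⇒within {t = t} here v∈ = let x , l = leafAt t v∈ in x , here , l
  ∈label⇒within (left q)  v∈ = let x , w , l = ∈label⇒within q v∈ in left x , left w , left l
  ∈label⇒within (right q) v∈ = let x , w , l = ∈label⇒within q v∈ in right x , right w , right l

  -- Two distinct children rule out degree at most 1, so that leaves of the graph are exactly leaves
  -- of the tree of cuts; having no further child keeps the degree at most 3.
  record Internal (x : Node t) : Set where
    field
      {c₁ c₂}  : Node t
      child₁   : Child x c₁
      child₂   : Child x c₂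
      c₁≢c₂    : c₁ ≢ c₂
      children : ∀ {y} → Child x y → y ≡ c₁ ⊎ y ≡ c₂

  leaf⊎internal : (x : Node t) → ∃ (IsLeaf x) ⊎ Internal x
  leaf⊎internal {t = leaf _}       here = inj₁ (_ , here)
  leaf⊎internal {t = node _ _ _} here = inj₂ record
    { child₁ = hereˡ ; child₂ = hereʳ ; c₁≢c₂ = λ ()
    ; children = λ { hereˡ → inj₁ refl ; hereʳ → inj₂ refl } }
  leaf⊎internal (left x) with leaf⊎internal x
  ... | inj₁ (v , l) = inj₁ (v , left l)
  ... | inj₂ i = inj₂ record
    { child₁ = left (Internal.child₁ i) ; child₂ = left (Internal.child₂ i)
    ; c₁≢c₂ = λ { refl → Internal.c₁≢c₂ i refl }
    ; children = λ { (left c) → [ inj₁ ∘ cong left , inj₂ ∘ cong left ]′ (Internal.children i c) } }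
  leaf⊎internal (right x) with leaf⊎internal x
  ... | inj₁ (v , l) = inj₁ (v , right l)
  ... | inj₂ i = inj₂ record
    { child₁ = right (Internal.child₁ i) ; child₂ = right (Internal.child₂ i)
    ; c₁≢c₂ = λ { refl → Internal.c₁≢c₂ i refl }
    ; children = λ { (right c) → [ inj₁ ∘ cong right , inj₂ ∘ cong right ]′ (Internal.children i c) } }

  #nodes : Cuts P A₁ → ℕ
  #nodes (leaf _)       = 1
  #nodes (node _ l r) = suc (#nodes l ℕ.+ #nodes r)

  -- The preorder numbering: root, left subtree, right subtree.
  encode : Node t → Fin (#nodes t)
  encode {t = leaf _}       here      = zero
  encode {t = node _ _ _} here      = zero
  encode {t = node _ l r} (left x)  = suc (encode x ↑ˡ #nodes r)
  encode {t = node _ l r} (right x) = suc (#nodes l ↑ʳ encode x)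

  decode : (t : Cuts P A₁) → Fin (#nodes t) → Node t
  decode (leaf _)       _       = here
  decode (node _ _ _) zero    = here
  decode (node _ l r) (suc i) = [ left ∘ decode l , right ∘ decode r ]′ (splitAt (#nodes l) i)

  decode-encode : (x : Node t) → decode t (encode x) ≡ x
  decode-encode {t = leaf _}       here = refl
  decode-encode {t = node _ _ _} here = refl
  decode-encode {t = node _ l r} (left x)
    rewrite Fin.splitAt-↑ˡ (#nodes l) (encode x) (#nodes r) = cong left (decode-encode x)
  decode-encode {t = node _ l r} (right x)
    rewrite Fin.splitAt-↑ʳ (#nodes l) (#nodes r) (encode x) = cong right (decode-encode x)

  encode-decode : (t : Cuts P A₁) (i : Fin (#nodes t)) → encode (decode t i) ≡ i
  encode-decode (leaf _)       zero = refl
  encode-decode (node _ _ _) zero = refl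
  encode-decode (node _ l r) (suc i) with splitAt (#nodes l) i in eq
  ... | inj₁ j = cong suc (trans (cong (_↑ˡ #nodes r) (encode-decode l j)) (Fin.splitAt⁻¹-↑ˡ eq))
  ... | inj₂ j = cong suc (trans (cong (#nodes l ↑ʳ_) (encode-decode r j)) (Fin.splitAt⁻¹-↑ʳ {i = i} eq))

-- The graph of a tree of cuts

module _ {A : Subset n} (t : Cuts P A) where

  Adjacent : Node t → Node t → Set
  Adjacent x y = Child x y ⊎ Child y x

  adjacent? : ∀ i j → Dec (Adjacent (decode t i) (decode t j))
  adjacent? i j = child? (decode t i) (decode t j) ⊎-dec child? (decode t j) (decode t i)

  opaque
    treeOf : Graph (#nodes t)
    treeOf = fromRelation ⊤ adjacent? swap [ child-irrefl , child-irrefl ]′ (λ _ → ∈⊤)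

    ∈treeOf : ∀ {i} → i ∈ V treeOf
    ∈treeOf = ∈⊤

    edge⁻ : ∀ {i j} → Graph._~_ treeOf i j → Adjacent (decode t i) (decode t j)
    edge⁻ {i} {j} = toWitness {a? = adjacent? i j}

    edge⁺ : ∀ {i j} → Adjacent (decode t i) (decode t j) → Graph._~_ treeOf i j
    edge⁺ {i} {j} = fromWitness {a? = adjacent? i j}

  open Graph treeOf using (_~_)

  child-edge : ∀ {x y : Node t} → Child x y → encode x ~ encode y
  child-edge c = edge⁺ (inj₁ (subst₂ Child (sym (decode-encode _)) (sym (decode-encode _)) c))

  decode-injective : ∀ {i j} → decode t i ≡ decode t j → i ≡ j
  decode-injective {i} {j} eq =
    trans (sym (encode-decode t i)) (trans (cong encode eq) (encode-decode t j))

  decode≡⇒≡encode : ∀ {i x} → decode t i ≡ x → i ≡ encode x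
  decode≡⇒≡encode {i} eq = trans (sym (encode-decode t i)) (cong encode eq)

  -- The embedding `ι` lets the recursion descend into a subtree `s` while the path stays in the
  -- graph of the whole tree `t`.
  from-root : ∀ {B} {s : Cuts P B} (ι : Node s → Node t) → (∀ {x y} → Child x y → Child (ι x) (ι y)) →
              ∀ x → Path treeOf (V treeOf) (encode (ι here)) (encode (ι x))
  from-root ι ι-child here      = stop ∈treeOf
  from-root ι ι-child (left x)  = Path-trans
    (Path-snoc (stop ∈treeOf) (child-edge (ι-child hereˡ)) ∈treeOf)
    (from-root (ι ∘ left) (ι-child ∘ left) x)
  from-root ι ι-child (right x) = Path-trans
    (Path-snoc (stop ∈treeOf) (child-edge (ι-child hereʳ)) ∈treeOf)
    (from-root (ι ∘ right) (ι-child ∘ right) x)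

  treeOf-connected : Connected treeOf
  treeOf-connected {i} {j} _ _ = Path-trans (reverse treeOf (root i)) (root j)
    where
    root : ∀ i → Path treeOf (V treeOf) (encode here) i
    root i = subst (Path treeOf _ _) (encode-decode t i) (from-root id id (decode t i))

  descendants : Node t → Subset (#nodes t)
  descendants q = ⟦ (λ i → within? q (decode t i)) ⟧

  -- A step up from a descendant of `a` stays among the descendants unless it starts at `a`, and the
  -- parent of `a` is unique. Hence every edge is a bridge, which gives acyclicity and also
  -- identifies the two sides of the edge.
  child-separates : ∀ {a b} → Child (decode t b) (decode t a) →
                    Separates treeOf (descendants (decode t a)) a b
  child-separates {a} {b} c = record
    { a∈S      = desc⁺ (within-refl _)
    ; b∉S      = parent-not-within c ∘ desc⁻
    ; crossing = λ x∈ y∉ e → cross (desc⁻ x∈) (y∉ ∘ desc⁺) (edge⁻ e)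
    }
    where
    desc⁺ : ∀ {i} → Within (decode t a) (decode t i) → i ∈ descendants (decode t a)
    desc⁺ = ∈⟦⟧⁺ (λ i → within? (decode t a) (decode t i))
    desc⁻ : ∀ {i} → i ∈ descendants (decode t a) → Within (decode t a) (decode t i)
    desc⁻ = ∈⟦⟧⁻ (λ i → within? (decode t a) (decode t i))

    cross : ∀ {x y} → Within (decode t a) (decode t x) → ¬ Within (decode t a) (decode t y) →
            Adjacent (decode t x) (decode t y) → x ≡ a × y ≡ b
    cross wx ¬wy (inj₁ c′) = contradiction (within-child wx c′) ¬wy
    cross wx ¬wy (inj₂ c′) with within-parent wx c′
    ... | inj₁ wy  = contradiction wy ¬wy
    ... | inj₂ x≡a = decode-injective x≡a ,
      decode-injective (parent-unique (subst (Child _) x≡a c′) c)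

  treeOf-isTree : IsTree treeOf
  treeOf-isTree = treeOf-connected , bridges⇒acyclic λ e → bridge (edge⁻ e)
    where
    bridge : ∀ {a b} → Adjacent (decode t a) (decode t b) →
             ∃ λ S → Separates treeOf S a b ⊎ Separates treeOf S b a
    bridge (inj₁ c) = _ , inj₂ (child-separates c)
    bridge (inj₂ c) = _ , inj₁ (child-separates c)

  leaf-degree : ∀ {i v} → IsLeaf (decode t i) v → degree treeOf i ≤ 1
  leaf-degree {i} l = subsingleton⇒∣p∣≤1 (N treeOf i) λ j∈ k∈ →
    same (edge⁻ (∈N⁻ treeOf j∈)) (edge⁻ (∈N⁻ treeOf k∈))
    where
    same : ∀ {j k} → Adjacent (decode t i) (decode t j) → Adjacent (decode t i) (decode t k) → j ≡ k
    same (inj₁ c) _         = contradiction c (leaf-childless l)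
    same (inj₂ _) (inj₁ c)  = contradiction c (leaf-childless l)
    same (inj₂ c) (inj₂ c′) = decode-injective (parent-unique c c′)

  child∈N : ∀ {i y} → Child (decode t i) y → encode y ∈ N treeOf i
  child∈N c = ∈N⁺ treeOf (edge⁺ (inj₁ (subst (Child _) (sym (decode-encode _)) c)))

  degree≤1⇒leaf : ∀ {i} → degree treeOf i ≤ 1 → ∃ (IsLeaf (decode t i))
  degree≤1⇒leaf {i} deg≤1 with leaf⊎internal (decode t i)
  ... | inj₁ l = l
  ... | inj₂ x = contradiction
    (trans (sym (decode-encode _)) (trans
      (cong (decode t) (∣p∣≤1⇒x≡y deg≤1 (child∈N (Internal.child₁ x)) (child∈N (Internal.child₂ x))))
      (decode-encode _)))
    (Internal.c₁≢c₂ x)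

  degree≤3 : ∀ i → degree treeOf i ≤ 3
  degree≤3 i with leaf⊎internal (decode t i)
  ... | inj₁ (_ , l) = ≤-trans (leaf-degree {i} l) (s≤s z≤n)
  ... | inj₂ x = begin
    ∣ N treeOf i ∣                                ≤⟨ ∣p∣≤1+∣p-x∣ (N treeOf i) (encode c₁) ⟩
    1 ℕ.+ ∣ N treeOf i - encode c₁ ∣              ≤⟨ s≤s (∣p∣≤1+∣p-x∣ (N treeOf i - encode c₁) (encode c₂)) ⟩
    2 ℕ.+ ∣ N treeOf i - encode c₁ - encode c₂ ∣  ≤⟨ s≤s (s≤s (subsingleton⇒∣p∣≤1 _ same)) ⟩
    3                                             ∎
    where
    open ≤-Reasoning
    open Internal x
    parent : ∀ {j} → j ∈ N treeOf i - encode c₁ - encode c₂ → Child (decode t j) (decode t i)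
    parent j∈ with j∈′ , j≢c₂ ← x∈p-y⁻ (N treeOf i - encode c₁) j∈
              with j∈N , j≢c₁ ← x∈p-y⁻ (N treeOf i) j∈′
              with edge⁻ (∈N⁻ treeOf j∈N)
    ... | inj₂ c = c
    ... | inj₁ c with children c
    ...   | inj₁ j≡c₁ = contradiction (decode≡⇒≡encode j≡c₁) j≢c₁
    ...   | inj₂ j≡c₂ = contradiction (decode≡⇒≡encode j≡c₂) j≢c₂
    same : ∀ {j k} → j ∈ N treeOf i - encode c₁ - encode c₂ →
           k ∈ N treeOf i - encode c₁ - encode c₂ → j ≡ k
    same j∈ k∈ = decode-injective (parent-unique (parent j∈) (parent k∈))

module _ {G : Graph n} {w : ℕ} (t : Cuts (BoundedCut G w) (V G)) where

  private
    leafNode : Vertex G → Node t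
    leafNode (_ , v∈V) = proj₁ (leafAt t v∈V)

    isLeaf : ∀ v → IsLeaf (leafNode v) (proj₁ v)
    isLeaf (_ , v∈V) = proj₂ (leafAt t v∈V)

    toLeaf : Vertex G → Leaf (treeOf t)
    toLeaf v = encode (leafNode v) , ∈treeOf t , leaf-degree t {encode (leafNode v)}
      (subst (λ x → IsLeaf x (proj₁ v)) (sym (decode-encode _)) (isLeaf v))

    Vertex-≡ : {x y : Vertex G} → proj₁ x ≡ proj₁ y → x ≡ y
    Vertex-≡ {_ , x∈} {_ , y∈} refl = cong (_ ,_) ([]=-irrelevant x∈ y∈)

    toLeaf-injective : ∀ {x y} → toLeaf x ≡ toLeaf y → x ≡ y
    toLeaf-injective {x} {y} eq = Vertex-≡ (leaf-value (isLeaf x)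
      (subst (λ z → IsLeaf z (proj₁ y)) (sym same-node) (isLeaf y)))
      where
      same-node : leafNode x ≡ leafNode y
      same-node = trans (sym (decode-encode _))
        (trans (cong (decode t ∘ proj₁) eq) (decode-encode _))

    toLeaf-surjective : ∀ l → ∃ λ v → ∀ {z} → z ≡ v → toLeaf z ≡ l
    toLeaf-surjective (i , i∈ , deg≤1) with v , l ← degree≤1⇒leaf t {i} deg≤1 =
      (v , leaf∈ l) , λ { refl → Leaf-≡ {T = treeOf t}
        (trans (cong encode (leaf-unique (isLeaf _) l)) (encode-decode t i)) }

  decomposition : RankDecomposition G
  decomposition = record
    { tree      = treeOf t
    ; isTree    = treeOf-isTree t
    ; maxDegree = λ {i} _ → degree≤3 t i
    ; μ         = mk⤖ {to = toLeaf} (toLeaf-injective , toLeaf-surjective)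
    }

  open RankDecomposition decomposition using (side; width)
  open Graph (treeOf t) using (_~_; ~-sym)

  private
    side≡preimage : ∀ {a b} → a ~ b →
                    side a b ≡ preimage G (encode ∘ leafNode) (branch (treeOf t) a b)
    side≡preimage a~b = cong (preimage G (encode ∘ leafNode)) (component≡branch (treeOf-isTree t) a~b)

    module _ {a b} (c : Child (decode t b) (decode t a)) where
      a~b : a ~ b
      a~b = edge⁺ t (inj₂ c)

      leaf-within : ∀ {v} → encode (leafNode v) ∈ descendants t (decode t a) → proj₁ v ∈ label (decode t a)
      leaf-within {v} ∈desc = within⇒∈label
        (subst (Within _) (decode-encode _)
          (∈⟦⟧⁻ (λ i → within? (decode t a) (decode t i)) ∈desc)) (isLeaf v)

      within-leaf : ∀ {v} → proj₁ v ∈ label (decode t a) → encode (leafNode v) ∈ descendants t (decode t a)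
      within-leaf {v} v∈ with x , w , l ← ∈label⇒within (decode t a) v∈ =
        ∈⟦⟧⁺ (λ i → within? (decode t a) (decode t i))
          (subst (Within _) (trans (leaf-unique l (isLeaf v)) (sym (decode-encode _))) w)

      side-child : side a b ≡ label (decode t a)
      side-child = trans (side≡preimage a~b) (⊆-antisym
        (λ v∈ → let v∈V , ∈branch = preimage⁻ G v∈ in
          leaf-within (branch-inside (treeOf-isTree t) (child-separates t c) a~b ∈branch))
        (λ v∈ → let v∈V = label⊆ (decode t a) v∈ in preimage⁺ G v∈V
          (inside⇒branch (treeOf-isTree t) (child-separates t c) a~b (∈treeOf t) (within-leaf v∈))))

      side-parent : side b a ≡ V G ─ label (decode t a)
      side-parent = trans (side≡preimage (~-sym a~b)) (⊆-antisym
        (λ v∈ → let v∈V , ∈branch = preimage⁻ G v∈ in x∈p∧x∉q⇒x∈p─q v∈V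
          λ v∈label → branch-outside (treeOf-isTree t) (child-separates t c) a~b ∈branch
            (within-leaf {_ , v∈V} v∈label))
        (λ v∈ → let v∈V , v∉ = x∈p─q⁻ (V G) _ v∈ in preimage⁺ G v∈V
          (outside⇒branch (treeOf-isTree t) (child-separates t c) a~b (∈treeOf t)
            (v∉ ∘ leaf-within {_ , v∈V}))))

    cutRank-side : ∀ {a b} → Adjacent t (decode t a) (decode t b) → cutRank G (side a b) ≤ w
    cutRank-side {a} {b} (inj₂ c) =
      subst (λ S → cutRank G S ≤ w) (sym (side-child c)) (BoundedCut.inner (label-P (decode t a)))
    cutRank-side {a} {b} (inj₁ c) =
      subst (λ S → cutRank G S ≤ w) (sym (side-parent c)) (BoundedCut.outer (label-P (decode t b)))

  decomposition-width : width ≤ w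
  decomposition-width = maxOver-≤ (V (treeOf t)) λ {a} _ → maxOver-≤ (N (treeOf t) a) λ b∈ →
    cutRank-side (edge⁻ t (∈N⁻ (treeOf t) b∈))

-- Gluing along a tree decomposition of a torso

⋃[_] : Subset m → (Fin m → Subset n) → Subset n
⋃[ [] ]          f = ⊥
⋃[ inside  ∷ S ] f = f zero ∪ ⋃[ S ] (f ∘ suc)
⋃[ outside ∷ S ] f = ⋃[ S ] (f ∘ suc)

∈⋃⁺ : ∀ {S : Subset m} {f : Fin m → Subset n} {i x} → i ∈ S → x ∈ f i → x ∈ ⋃[ S ] f
∈⋃⁺ {S = inside  ∷ S} here       x∈ = p⊆p∪q _ x∈
∈⋃⁺ {S = inside  ∷ S} (there i∈) x∈ = q⊆p∪q _ _ (∈⋃⁺ i∈ x∈)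
∈⋃⁺ {S = outside ∷ S} (there i∈) x∈ = ∈⋃⁺ i∈ x∈

∈⋃⁻ : ∀ (S : Subset m) {f : Fin m → Subset n} {x} → x ∈ ⋃[ S ] f → ∃ λ i → i ∈ S × x ∈ f i
∈⋃⁻ []            x∈ = contradiction x∈ ∉⊥
∈⋃⁻ (inside ∷ S) {f} x∈ with x∈p∪q⁻ (f zero) _ x∈
... | inj₁ x∈f = zero , here , x∈f
... | inj₂ x∈⋃ = let i , i∈ , x∈f = ∈⋃⁻ S x∈⋃ in suc i , there i∈ , x∈f
∈⋃⁻ (outside ∷ S) x∈ = let i , i∈ , x∈f = ∈⋃⁻ S x∈ in suc i , there i∈ , x∈f

module _ {n : ℕ} {P Q : Subset n → Set}
         (Q⇒P : ∀ {A} → Q A → P A) (Q-⊥ : Q ⊥) (Q-∪ : ∀ {A B} → Q A → Q B → Q (A ∪ B)) where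

  -- Every intermediate union needs `P`, which need not be closed under unions. The stronger `Q` is,
  -- and is carried along; it will be `Covers G S` for a bag, with `P` the bound on the cut-rank.
  join-all : ∀ (S : Subset m) (f : Fin m → Subset n) →
             (∀ {i j x} → i ∈ S → j ∈ S → x ∈ f i → x ∈ f j → i ≡ j) →
             (∀ {i} → i ∈ S → Cuts∅ P (f i) × Q (f i)) → Cuts∅ P (⋃[ S ] f) × Q (⋃[ S ] f)
  join-all []            f d h = inj₁ (λ (_ , x∈) → ∉⊥ x∈) , Q-⊥
  join-all (outside ∷ S) f d h =
    join-all S (f ∘ suc) (λ i∈ j∈ x∈ x∈′ → Fin.suc-injective (d (there i∈) (there j∈) x∈ x∈′)) (h ∘ there)
  join-all (inside ∷ S)  f d h
    with t , q ← h here
    with ts , qs ← join-all S (f ∘ suc)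
      (λ i∈ j∈ x∈ x∈′ → Fin.suc-injective (d (there i∈) (there j∈) x∈ x∈′)) (h ∘ there) =
    join (λ x∈ x∈⋃ → let i , i∈ , x∈′ = ∈⋃⁻ S x∈⋃ in Fin.0≢1+n (d here (there i∈) x∈ x∈′))
      (Q⇒P (Q-∪ q qs)) t ts , Q-∪ q qs

⌊⌋-cong : ∀ {b} {R : Set} (R? : Dec R) → (Bool.T b → R) → (R → Bool.T b) → b ≡ ⌊ R? ⌋
⌊⌋-cong R? to from = Bool.⇔→≡ (mk⇔
  (λ b≡ → T⇒≡true (fromWitness {a? = R?} (to (≡true⇒T b≡))))
  (λ r≡ → T⇒≡true (from (toWitness {a? = R?} (≡true⇒T r≡)))))

module _ (G : Graph n) (S : Subset n) where
  induced⁻ : ∀ {x y} → Graph._~_ (G [ S ]) x y → x ∈ S × y ∈ S × Graph._~_ G x y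
  induced⁻ = toWitness

  induced⁺ : ∀ {x y} → x ∈ S → y ∈ S → Graph._~_ G x y → Graph._~_ (G [ S ]) x y
  induced⁺ x∈S y∈S e = fromWitness (x∈S , y∈S , e)

  induced-adj : ∀ {x y} → x ∈ S → y ∈ S → adj G x y ≡ adj (G [ S ]) x y
  induced-adj {x} {y} x∈S y∈S =
    ⌊⌋-cong ((x ∈? S) ×-dec (y ∈? S) ×-dec T? (adj G x y)) (λ e → x∈S , y∈S , e) (proj₂ ∘ proj₂)

-- Branches and cliques in a tree decomposition

module _ {H : Graph n} (D : TreeDecomposition H) where
  open TreeDecomposition D renaming (tree to T) hiding (width)
  open Graph T using (_~_; ~-sym; ~⇒∈)

  -- The nodes whose bags contain `v` induce a connected subgraph that avoids `a`, so they all lie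
  -- in one branch at `a`.
  bag-branch : ∀ {v a b t t′} → v ∈ V H → v ∉ bag a → t ∈ V T → v ∈ bag t → t′ ∈ V T → v ∈ bag t′ →
               t ∈ branch T b a → t′ ∈ branch T b a
  bag-branch {v} {a} v∈V v∉a t∈V v∈t t′∈V v∈t′ t∈ = branch-trans t∈
    (Path-map bags⊆ (λ _ _ e → proj₂ (proj₂ (induced⁻ T bags e)))
      (connected v∈V (x∈p∩q⁺ (t∈V , bags⁺ v∈t)) (x∈p∩q⁺ (t′∈V , bags⁺ v∈t′))))
    where
    bags : Subset size
    bags = ⟦ (λ t → v ∈? bag t) ⟧
    bags⁺ : ∀ {t} → v ∈ bag t → t ∈ bags
    bags⁺ = ∈⟦⟧⁺ (λ t → v ∈? bag t)
    bags⊆ : V T ∩ bags ⊆ V T - a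
    bags⊆ s∈ with s∈V , s∈bags ← x∈p∩q⁻ (V T) bags s∈ =
      x∈p∧x≢y⇒x∈p-y s∈V λ { refl → v∉a (∈⟦⟧⁻ (λ t → v ∈? bag t) s∈bags) }

  -- Some v ∈ K is missing from the bag of a unless that bag contains K, and then all of K has
  -- bags in the branch at a containing the bags of v.
  clique⊆bag : ∀ {r} → r ∈ V T → ∀ (K : Subset n) → K ⊆ V H →
               (∀ {u v} → u ∈ K → v ∈ K → u ≢ v → Graph._~_ H u v) → ∃ λ t → t ∈ V T × K ⊆ bag t
  clique⊆bag {r} r∈V K K⊆V clique with nonempty? (K ─ bag r)
  ... | no none = r , r∈V , Empty-─⇒⊆ none
  ... | yes (v , v∈) = start (x∈p─q⁻ K (bag r) v∈)
    where
    Goal : Set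
    Goal = ∃ λ t → t ∈ V T × K ⊆ bag t

    shared : ∀ {u v} → u ∈ K → v ∈ K → ∃ λ t → t ∈ V T × u ∈ bag t × v ∈ bag t
    shared {u} {v} u∈K v∈K with u Fin.≟ v
    ... | yes refl = let t , t∈V , u∈t = coversV (K⊆V u∈K) in t , t∈V , u∈t , u∈t
    ... | no u≢v   = coversE (clique u∈K v∈K u≢v)

    Meets : Fin size → Fin size → Set
    Meets a p = ∀ {u} → u ∈ K → ∃ λ t → t ∈ V T × u ∈ bag t × t ∈ branch T a p

    follow : ∀ {v a b t} → v ∈ K → v ∉ bag a → t ∈ V T → v ∈ bag t → t ∈ branch T b a → Meets b a
    follow v∈K v∉a t∈V v∈t t∈ u∈K with s , s∈V , u∈s , v∈s ← shared u∈K v∈K =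
      s , s∈V , u∈s , bag-branch (K⊆V v∈K) v∉a t∈V v∈t s∈V v∈s t∈

    search : ∀ {a p} → a ~ p → Meets a p → Goal
    search = branch-induction isTree (λ a p → Meets a p → Goal) descend
      where
      descend : ∀ {a p} → a ~ p → (∀ {b} → a ~ b → b ≢ p → Meets b a → Goal) → Meets a p → Goal
      descend {a} a~p ih meets with nonempty? (K ─ bag a)
      ... | no none = a , ~⇒∈ a~p , Empty-─⇒⊆ none
      -- By the invariant `Meets`, `v` has a bag on the side of `a` away from `p`, so the search
      -- never turns back.
      ... | yes (v , v∈) with v∈K , v∉a ← x∈p─q⁻ K (bag a) v∈ with t , t∈V , v∈t , t∈ ← meets v∈K
                         with branch-unfold t∈
      ...   | inj₁ refl = contradiction v∈t v∉a
      ...   | inj₂ (b , a~b , b≢p , t∈b) = ih a~b b≢p (follow v∈K v∉a t∈V v∈t t∈b)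

    start : ∀ {v} → v ∈ K × v ∉ bag r → Goal
    start (v∈K , v∉r) with t , t∈V , v∈t ← coversV (K⊆V v∈K) with root-cover isTree r∈V t∈V
    ... | inj₁ refl            = contradiction v∈t v∉r
    ... | inj₂ (b , r~b , t∈b) = search (~-sym r~b) (follow v∈K v∉r t∈V v∈t t∈b)

BoundedCut-weaken : ∀ {G : Graph n} {w w′ A} → w ≤ w′ → BoundedCut G w A → BoundedCut G w′ A
BoundedCut-weaken w≤w′ (ρ , ρ′) = ≤-trans ρ w≤w′ , ≤-trans ρ′ w≤w′

rw⇒cuts : ∀ {G : Graph n} {c u} → rw[ G ]≤ + c → u ∈ V G → Cuts (BoundedCut G c) (V G)
rw⇒cuts (_ , (D , refl) , width≤c) u∈V =
  Cuts-map (λ _ → BoundedCut-weaken (ℤ.drop‿+≤+ width≤c)) (rankDecomposition⇒cuts D u∈V)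

-- Depends on S only, unless S is empty.
pick : Subset n → Fin n → Fin n
pick S d with nonempty? S
... | yes (x , _) = x
... | no _        = d

pick-∈ : ∀ {S : Subset n} {d} → d ∈ S → pick S d ∈ S
pick-∈ {S = S} d∈S with nonempty? S
... | yes (_ , x∈S) = x∈S
... | no S≡∅        = contradiction (_ , d∈S) S≡∅

pick-unique : ∀ {S : Subset n} {d d′} → d ∈ S → pick S d ≡ pick S d′
pick-unique {S = S} d∈S with nonempty? S
... | yes _  = refl
... | no S≡∅ = contradiction (_ , d∈S) S≡∅

-- Parts, their gates, and the recursion along the tree decomposition

module _ (G : Graph n) (X : Subset n) (X⊆V : X ⊆ V G) where
  open Graph G using (_~_; ~-sym; ~-irrefl; ~⇒∈)

  private
    H : Graph n
    H = G [ X ]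

    H⊆X : V H ⊆ X
    H⊆X = p∩q⊆q (V G) X

    X⊆H : X ⊆ V H
    X⊆H x∈X = x∈p∩q⁺ (X⊆V x∈X , x∈X)

  -- The parts into which X divides G: the components of G[X] and the single vertices not in X.
  opaque
    part : Fin n → Subset n
    part v = ⟦ (λ y → (y Fin.≟ v) ⊎-dec path? H (V H) v y) ⟧

    part⁺ : ∀ {v y} → y ≡ v ⊎ Path H (V H) v y → y ∈ part v
    part⁺ {v} = ∈⟦⟧⁺ (λ y → (y Fin.≟ v) ⊎-dec path? H (V H) v y)

    part⁻ : ∀ {v y} → y ∈ part v → y ≡ v ⊎ Path H (V H) v y
    part⁻ {v} = ∈⟦⟧⁻ (λ y → (y Fin.≟ v) ⊎-dec path? H (V H) v y)

  v∈part : ∀ {v} → v ∈ part v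
  v∈part = part⁺ (inj₁ refl)

  part-sym : ∀ {v y} → y ∈ part v → v ∈ part y
  part-sym y∈ with part⁻ y∈
  ... | inj₁ refl = v∈part
  ... | inj₂ p    = part⁺ (inj₂ (reverse H p))

  part-trans : ∀ {v y z} → y ∈ part v → z ∈ part y → z ∈ part v
  part-trans y∈ z∈ with part⁻ y∈ | part⁻ z∈
  ... | inj₁ refl | _         = z∈
  ... | inj₂ _    | inj₁ refl = y∈
  ... | inj₂ p    | inj₂ q    = part⁺ (inj₂ (Path-trans p q))

  part-≡ : ∀ {v y} → y ∈ part v → part y ≡ part v
  part-≡ y∈ = ⊆-antisym (part-trans y∈) (part-trans (part-sym y∈))

  part-edge : ∀ {x y} → x ∈ X → y ∈ X → x ~ y → y ∈ part x
  part-edge x∈X y∈X e = part⁺ (inj₂ (Path-snoc (stop (X⊆H x∈X)) (induced⁺ G X x∈X y∈X e) (X⊆H y∈X)))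

  part-∉X : ∀ {v y} → v ∉ X → y ∈ part v → y ≡ v
  part-∉X v∉X y∈ with part⁻ y∈
  ... | inj₁ y≡v = y≡v
  ... | inj₂ p   = contradiction (H⊆X (Path-source p)) v∉X

  part-∈X : ∀ {v y} → v ∈ X → y ∈ part v → y ∈ X
  part-∈X v∈X y∈ with part⁻ y∈
  ... | inj₁ refl = v∈X
  ... | inj₂ p    = H⊆X (Path-target p)

  part-⊆V : ∀ {v} → v ∈ V G → part v ⊆ V G
  part-⊆V v∈V y∈ with part⁻ y∈
  ... | inj₁ refl = v∈V
  ... | inj₂ p    = X⊆V (H⊆X (Path-target p))

  part≡component : ∀ {v} → v ∈ X → part v ≡ V (H [ component H v ])
  part≡component {v} v∈X = ⊆-antisym to from
    where
    to : part v ⊆ V H ∩ component H v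
    to y∈ = x∈p∩q⁺ (X⊆H (part-∈X v∈X y∈) , ∈⟦⟧⁺ (path? H (V H) v) (path (part⁻ y∈)))
      where
      path : ∀ {y} → y ≡ v ⊎ Path H (V H) v y → Path H (V H) v y
      path (inj₁ refl) = stop (X⊆H v∈X)
      path (inj₂ p)    = p
    from : V H ∩ component H v ⊆ part v
    from y∈ = part⁺ (inj₂ (∈⟦⟧⁻ (path? H (V H) v) (p∩q⊆q (V H) _ y∈)))

  -- The only vertices through which edges of G leave a part C, namely N(C) if C ⊆ X and C if not.
  opaque
    gate : Subset n → Subset n
    gate C = ⟦ (λ u → (u ∈? (V G ─ X)) ×-dec
      ((u ∈? C) ⊎-dec Fin.any? (λ y → (y ∈? C) ×-dec (y ∈? X) ×-dec T? (adj G y u)))) ⟧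

    gate⁺ : ∀ {C u} → u ∈ V G ─ X → u ∈ C ⊎ (∃ λ y → y ∈ C × y ∈ X × y ~ u) → u ∈ gate C
    gate⁺ {C} u∈ h = ∈⟦⟧⁺ (λ u → (u ∈? (V G ─ X)) ×-dec
      ((u ∈? C) ⊎-dec Fin.any? (λ y → (y ∈? C) ×-dec (y ∈? X) ×-dec T? (adj G y u)))) (u∈ , h)

    gate⁻ : ∀ {C u} → u ∈ gate C → u ∈ V G ─ X × (u ∈ C ⊎ (∃ λ y → y ∈ C × y ∈ X × y ~ u))
    gate⁻ {C} = ∈⟦⟧⁻ (λ u → (u ∈? (V G ─ X)) ×-dec
      ((u ∈? C) ⊎-dec Fin.any? (λ y → (y ∈? C) ×-dec (y ∈? X) ×-dec T? (adj G y u))))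

  gate⊆ : ∀ {C} → gate C ⊆ V G ─ X
  gate⊆ u∈ = proj₁ (gate⁻ u∈)

  leave-component : ∀ {v x y} → v ∈ X → x ∈ part v → y ∉ part v → x ~ y → y ∈ gate (part v)
  leave-component {y = y} v∈X x∈ y∉ e with y ∈? X
  ... | yes y∈X = contradiction (part-trans x∈ (part-edge (part-∈X v∈X x∈) y∈X e)) y∉
  ... | no y∉X  = gate⁺ (x∈p∧x∉q⇒x∈p─q (~⇒∈ (~-sym e)) y∉X) (inj₂ (_ , x∈ , part-∈X v∈X x∈ , e))

  torso-edge : ∀ {u v} → u ∉ X → v ∉ X → u ~ v ⊎ (u ≢ v × Path G (X ∪ (⁅ u ⁆ ∪ ⁅ v ⁆)) u v) →
               Graph._~_ (G ⊚ X) u v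
  torso-edge u∉X v∉X e = fromWitness (u∉X , v∉X , e)

  -- Two neighbours of a component are joined by a path through it, with all internal vertices in
  -- `X`. The gate of a part not in `X` has only one vertex.
  gate-clique : ∀ {v u u′} → u ∈ gate (part v) → u′ ∈ gate (part v) → u ≢ u′ → Graph._~_ (G ⊚ X) u u′
  gate-clique {v} {u} {u′} u∈ u′∈ u≢u′ = torso-edge u∉X u′∉X (inj₂ (u≢u′ , path))
    where
    u∉X : u ∉ X
    u∉X = x∈p─q⇒x∉q (V G) X (gate⊆ u∈)
    u′∉X : u′ ∉ X
    u′∉X = x∈p─q⇒x∉q (V G) X (gate⊆ u′∈)

    neighbour : ∀ {u} → u ∈ gate (part v) → (v ∉ X × u ≡ v) ⊎ (v ∈ X × ∃ λ y → y ∈ part v × y ~ u)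
    neighbour u∈ with gate⁻ u∈ | v ∈? X
    ... | u∈V─X , inj₁ u∈part             | yes v∈X =
      contradiction (part-∈X v∈X u∈part) (x∈p─q⇒x∉q (V G) X u∈V─X)
    ... | _     , inj₁ u∈part             | no v∉X  = inj₁ (v∉X , part-∉X v∉X u∈part)
    ... | _     , inj₂ (y , y∈ , _ , e)   | yes v∈X = inj₂ (v∈X , y , y∈ , e)
    ... | _     , inj₂ (y , y∈ , y∈X , _) | no v∉X  =
      contradiction (subst (_∈ X) (part-∉X v∉X y∈) y∈X) v∉X

    path : Path G (X ∪ (⁅ u ⁆ ∪ ⁅ u′ ⁆)) u u′
    path with neighbour u∈ | neighbour u′∈
    ... | inj₁ (_ , u≡v)   | inj₁ (_ , u′≡v) = contradiction (trans u≡v (sym u′≡v)) u≢u′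
    ... | inj₁ (v∉X , _)   | inj₂ (v∈X , _)  = contradiction v∈X v∉X
    ... | inj₂ (v∈X , _)   | inj₁ (v∉X , _)  = contradiction v∈X v∉X
    ... | inj₂ (v∈X , y , y∈ , y~u) | inj₂ (_ , y′ , y′∈ , y′~u′) =
      Path-snoc (Path-trans (Path-snoc (stop u∈S) (~-sym y~u) (X⊆S (part-∈X v∈X y∈)))
        (within (part⁻ (part-trans (part-sym y∈) y′∈)))) y′~u′ u′∈S
      where
      X⊆S : X ⊆ X ∪ (⁅ u ⁆ ∪ ⁅ u′ ⁆)
      X⊆S = p⊆p∪q _
      u∈S : u ∈ X ∪ (⁅ u ⁆ ∪ ⁅ u′ ⁆)
      u∈S = q⊆p∪q X _ (p⊆p∪q _ (x∈⁅x⁆ u))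
      u′∈S : u′ ∈ X ∪ (⁅ u ⁆ ∪ ⁅ u′ ⁆)
      u′∈S = q⊆p∪q X _ (q⊆p∪q ⁅ u ⁆ _ (x∈⁅x⁆ u′))
      within : ∀ {y′} → y′ ≡ y ⊎ Path H (V H) y y′ → Path G (X ∪ (⁅ u ⁆ ∪ ⁅ u′ ⁆)) y y′
      within (inj₁ refl) = stop (X⊆S (part-∈X v∈X y∈))
      within (inj₂ p)    = Path-map (X⊆S ∘ H⊆X) (λ _ _ e → proj₂ (proj₂ (induced⁻ G X e))) p

  opaque
    -- One canonical vertex per part, so that whatever is chosen at `rep v` is shared by the whole
    -- part.
    rep : Fin n → Fin n
    rep v = pick (part v) v

    rep∈part : ∀ v → rep v ∈ part v
    rep∈part v = pick-∈ v∈part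

    rep-cong : ∀ {v y} → part y ≡ part v → rep y ≡ rep v
    rep-cong {v} {y} eq = trans (pick-unique v∈part) (cong (λ S → pick S v) eq)

  part-rep : ∀ v → part (rep v) ≡ part v
  part-rep v = part-≡ (rep∈part v)

  Covers-⊥ : ∀ {S} → Covers G S ⊥
  Covers-⊥ x∈⊥ = contradiction x∈⊥ ∉⊥

  Covers-∪ : ∀ {S A B} → Covers G S A → Covers G S B → Covers G S (A ∪ B)
  Covers-∪ {S} {A} {B} cA cB x∈ y∉ e with x∈p∪q⁻ A B x∈
  ... | inj₁ x∈A = cA x∈A (y∉ ∘ p⊆p∪q B) e
  ... | inj₂ x∈B = cB x∈B (y∉ ∘ q⊆p∪q A B) e

  -- A record, unlike the function type itself, is not unfolded by with-abstractions.
  record Torso (c : ℕ) : Set where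
    field
      components : ∀ {u} → u ∈ X → 𝓡 c (H [ component H u ])

  module _ (c K : ℕ) (torso : Torso c) where

    private
      Good : Subset n → Set
      Good = BoundedCut G (c ℕ.+ K)

    Covers⇒Good : ∀ {S A} → ∣ S ∣ ≤ K → Covers G S A → Good A
    Covers⇒Good ∣S∣≤K cov = BoundedCut-weaken (≤-trans ∣S∣≤K (m≤n+m K c)) (cutRank-cover G cov)

    module _ {S : Subset n} (∣S∣≤K : ∣ S ∣ ≤ K) where

      -- For a component the outer end of a leaving edge is in the gate; for a single vertex outside
      -- `X` the inner end is.
      part-covers : ∀ {v} → v ∈ V G → gate (part v) ⊆ S → Covers G S (part v)
      part-covers {v} v∈V gate⊆S {x} {y} x∈ y∉ e with v ∈? X
      ... | yes v∈X = inj₂ (gate⊆S (leave-component v∈X x∈ y∉ e))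
      ... | no v∉X with refl ← part-∉X v∉X x∈ =
        inj₁ (gate⊆S (gate⁺ (x∈p∧x∉q⇒x∈p─q v∈V v∉X) (inj₁ x∈)))

      component-cuts : ∀ {v} → v ∈ X → gate (part v) ⊆ S → Cuts Good (part v)
      component-cuts {v} v∈X gate⊆S = subst (Cuts Good) (sym part≡)
        (Cuts-map extend (rw⇒cuts (Torso.components torso v∈X) (subst (v ∈_) part≡ v∈part)))
        where
        C : Subset n
        C = component H v

        part≡ : part v ≡ V (H [ C ])
        part≡ = part≡component v∈X

        neighbour : ∀ {x y} → x ∈ part v → x ~ y → y ∈ part v ⊎ y ∈ S
        neighbour {y = y} x∈ e with y ∈? part v
        ... | yes y∈ = inj₁ y∈
        ... | no y∉  = inj₂ (gate⊆S (leave-component v∈X x∈ y∉ e))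

        extend : ∀ {A} → A ⊆ V (H [ C ]) → BoundedCut (H [ C ]) c A → Good A
        extend A⊆ cut = BoundedCut-weaken (+-monoʳ-≤ c ∣S∣≤K)
          (cutRank-extend G (H [ C ])
            (λ x∈ y∈ → trans (induced-adj G X (H⊆X (p∩q⊆p _ C x∈)) (H⊆X (p∩q⊆p _ C y∈)))
              (induced-adj H C (p∩q⊆q (V H) C x∈) (p∩q⊆q (V H) C y∈)))
            (subst (λ Z → ∀ {x y} → x ∈ Z → x ~ y → y ∈ Z ⊎ y ∈ S) part≡ neighbour) A⊆ cut)

      part-cuts : ∀ {v} → v ∈ V G → gate (part v) ⊆ S → Cuts Good (part v)
      part-cuts {v} v∈V gate⊆S with v ∈? X
      ... | yes v∈X = component-cuts v∈X gate⊆S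
      ... | no v∉X  = subst (Cuts Good) (sym part≡v)
        (leaf (subst Good part≡v (Covers⇒Good ∣S∣≤K (part-covers v∈V gate⊆S))))
        where
        part≡v : part v ≡ ⁅ v ⁆
        part≡v = ⊆-antisym (λ y∈ → subst (_∈ ⁅ v ⁆) (sym (part-∉X v∉X y∈)) (x∈⁅x⁆ v))
          (λ y∈ → subst (_∈ part v) (sym (x∈⁅y⁆⇒x≡y v y∈)) v∈part)

      -- A union of parts is the disjoint union of the parts of its representatives.
      parts-cuts : (A : Subset n) → A ⊆ V G → (∀ {v} → v ∈ A → part v ⊆ A) →
                   (∀ {v} → v ∈ A → gate (part v) ⊆ S) → Cuts∅ Good A × Covers G S A
      parts-cuts A A⊆V closed gates = subst (λ Z → Cuts∅ Good Z × Covers G S Z) ⋃≡A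
        (join-all (Covers⇒Good ∣S∣≤K) (Covers-⊥ {S}) (Covers-∪ {S}) reps part distinct λ i∈ →
          let i∈A = proj₁ (reps⁻ i∈) in
          inj₂ (part-cuts (A⊆V i∈A) (gates i∈A)) , part-covers (A⊆V i∈A) (gates i∈A))
        where
        rep? : ∀ v → Dec (v ∈ A × rep v ≡ v)
        rep? v = (v ∈? A) ×-dec (rep v Fin.≟ v)

        reps : Subset n
        reps = ⟦ rep? ⟧

        reps⁻ : ∀ {v} → v ∈ reps → v ∈ A × rep v ≡ v
        reps⁻ = ∈⟦⟧⁻ rep?

        distinct : ∀ {i j v} → i ∈ reps → j ∈ reps → v ∈ part i → v ∈ part j → i ≡ j
        distinct i∈ j∈ v∈i v∈j = trans (sym (proj₂ (reps⁻ i∈)))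
          (trans (rep-cong (trans (sym (part-≡ v∈i)) (part-≡ v∈j))) (proj₂ (reps⁻ j∈)))

        ⋃≡A : ⋃[ reps ] part ≡ A
        ⋃≡A = ⊆-antisym
          (λ v∈ → let i , i∈ , v∈part = ∈⋃⁻ reps v∈ in closed (proj₁ (reps⁻ i∈)) v∈part)
          (λ {v} v∈A → ∈⋃⁺ (∈⟦⟧⁺ rep? (closed v∈A (rep∈part v) , rep-cong (part-rep v)))
            (part-sym (rep∈part v)))

    module _ (D : TreeDecomposition (G ⊚ X))
             (∣bag∣≤K : ∀ {t} → t ∈ V (TreeDecomposition.tree D) → ∣ TreeDecomposition.bag D t ∣ ≤ K)
             {r : Fin (TreeDecomposition.size D)} (r∈T : r ∈ V (TreeDecomposition.tree D)) where
      open TreeDecomposition D using (size; bag; coversE; isTree) renaming (tree to T)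
      open Graph T using () renaming (_~_ to _~ᵀ_; ~-sym to ~ᵀ-sym; ~⇒∈ to ~ᵀ⇒∈)

      opaque
        home : ∀ v → ∃ λ t → t ∈ V T × gate (part v) ⊆ bag t
        home v = clique⊆bag D r∈T (gate (part v)) gate⊆ gate-clique

        -- Going through `rep` makes `τ` constant on parts, so no component is divided among several
        -- nodes.
        τ : Fin n → Fin size
        τ v = proj₁ (home (rep v))

        τ∈T : ∀ {v} → τ v ∈ V T
        τ∈T {v} = proj₁ (proj₂ (home (rep v)))

        gate⊆bag : ∀ {v} → gate (part v) ⊆ bag (τ v)
        gate⊆bag {v} u∈ = proj₂ (proj₂ (home (rep v))) (subst (λ C → _ ∈ gate C) (sym (part-rep v)) u∈)

        τ-part : ∀ {v y} → y ∈ part v → τ y ≡ τ v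
        τ-part y∈ = cong (proj₁ ∘ home) (rep-cong (part-≡ y∈))

        own : Fin size → Subset n
        own a = ⟦ (λ v → (v ∈? V G) ×-dec (τ v Fin.≟ a)) ⟧

        own⁺ : ∀ {a v} → v ∈ V G → τ v ≡ a → v ∈ own a
        own⁺ {a} v∈V τ≡a = ∈⟦⟧⁺ (λ v → (v ∈? V G) ×-dec (τ v Fin.≟ a)) (v∈V , τ≡a)

        own⁻ : ∀ {a v} → v ∈ own a → v ∈ V G × τ v ≡ a
        own⁻ {a} = ∈⟦⟧⁻ (λ v → (v ∈? V G) ×-dec (τ v Fin.≟ a))

        below : Fin size → Fin size → Subset n
        below a p = ⟦ (λ v → (v ∈? V G) ×-dec (τ v ∈? branch T a p)) ⟧

        below⁺ : ∀ {a p v} → v ∈ V G → τ v ∈ branch T a p → v ∈ below a p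
        below⁺ {a} {p} v∈V τ∈ = ∈⟦⟧⁺ (λ v → (v ∈? V G) ×-dec (τ v ∈? branch T a p)) (v∈V , τ∈)

        below⁻ : ∀ {a p v} → v ∈ below a p → v ∈ V G × τ v ∈ branch T a p
        below⁻ {a} {p} = ∈⟦⟧⁻ (λ v → (v ∈? V G) ×-dec (τ v ∈? branch T a p))

      own-bag : ∀ {v} → v ∈ V G → v ∉ X → v ∈ bag (τ v)
      own-bag v∈V v∉X = gate⊆bag (gate⁺ (x∈p∧x∉q⇒x∈p─q v∈V v∉X) (inj₁ v∈part))

      neighbour-bag : ∀ {x y} → x ∈ X → y ∉ X → x ~ y → y ∈ bag (τ x)
      neighbour-bag x∈X y∉X e =
        gate⊆bag (gate⁺ (x∈p∧x∉q⇒x∈p─q (~⇒∈ (~-sym e)) y∉X) (inj₂ (_ , v∈part , x∈X , e)))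

      same-branch : ∀ {v a b t t′} → v ∈ V G → v ∉ X → v ∉ bag a → t ∈ V T → v ∈ bag t →
                    t′ ∈ V T → v ∈ bag t′ → t ∈ branch T b a → t′ ∈ branch T b a
      same-branch v∈V v∉X = bag-branch D (x∈p∧x∉q⇒x∈p─q v∈V v∉X)

      -- Ends both in `X` share a part and hence a node. If just one end is outside `X`, it lies in
      -- the bags at both `τ x` and `τ y`, so `bag-branch` applies to it. If both are outside, the
      -- edge survives in the torso, and a bag containing both ends links the two nodes.
      edge-branch : ∀ {x y a b} → x ~ y → x ∉ bag a → y ∉ bag a →
                    τ x ∈ branch T b a → τ y ∈ branch T b a
      edge-branch {x} {y} e x∉a y∉a τx∈ with x ∈? X | y ∈? X
      ... | yes x∈X | yes y∈X = subst (_∈ branch T _ _) (sym (τ-part (part-edge x∈X y∈X e))) τx∈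
      ... | yes x∈X | no y∉X  = same-branch (~⇒∈ (~-sym e)) y∉X y∉a τ∈T (neighbour-bag x∈X y∉X e)
        τ∈T (own-bag (~⇒∈ (~-sym e)) y∉X) τx∈
      ... | no x∉X  | yes y∈X = same-branch (~⇒∈ e) x∉X x∉a τ∈T (own-bag (~⇒∈ e) x∉X)
        τ∈T (neighbour-bag y∈X x∉X (~-sym e)) τx∈
      ... | no x∉X  | no y∉X
        with t , t∈T , x∈t , y∈t ← coversE (torso-edge x∉X y∉X (inj₁ e)) =
        same-branch (~⇒∈ (~-sym e)) y∉X y∉a t∈T y∈t τ∈T (own-bag (~⇒∈ (~-sym e)) y∉X)
          (same-branch (~⇒∈ e) x∉X x∉a τ∈T (own-bag (~⇒∈ e) x∉X) t∈T x∈t τx∈)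

      below-covers : ∀ {a b} → Covers G (bag a) (below b a)
      below-covers {a} {b} {x} {y} x∈ y∉ e with x ∈? bag a | y ∈? bag a
      ... | yes x∈a | _       = inj₁ x∈a
      ... | no _    | yes y∈a = inj₂ y∈a
      ... | no x∉a  | no y∉a  = contradiction
        (below⁺ (~⇒∈ (~-sym e)) (edge-branch e x∉a y∉a (proj₂ (below⁻ x∈)))) y∉

      -- `S` is all neighbours of `a` at the root and all but the parent elsewhere. The one set
      -- `bag a` covers the parts placed at `a`, each branch, and so every union formed on the way.
      node-cuts : ∀ {a} (S : Subset size) → a ∈ V T → (∀ {b} → b ∈ S → a ~ᵀ b) →
                  (∀ {b} → b ∈ S → Cuts∅ Good (below b a)) →
                  Cuts∅ Good (own a ∪ ⋃[ S ] (λ b → below b a))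
      node-cuts {a} S a∈T children cuts = join
        (λ v∈own v∈⋃ → let b , b∈ , v∈b = ∈⋃⁻ S v∈⋃ in
          p∉branch (subst (_∈ branch T b a) (proj₂ (own⁻ v∈own)) (proj₂ (below⁻ v∈b))))
        (Covers⇒Good (∣bag∣≤K a∈T) (Covers-∪ (proj₂ own-cuts) (proj₂ below-cuts)))
        (proj₁ own-cuts) (proj₁ below-cuts)
        where
        own-cuts : Cuts∅ Good (own a) × Covers G (bag a) (own a)
        own-cuts = parts-cuts (∣bag∣≤K a∈T) (own a) (proj₁ ∘ own⁻)
          (λ v∈ y∈ → let v∈V , τ≡a = own⁻ v∈ in own⁺ (part-⊆V v∈V y∈) (trans (τ-part y∈) τ≡a))
          (λ v∈ u∈ → subst (λ t → _ ∈ bag t) (proj₂ (own⁻ v∈)) (gate⊆bag u∈))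

        below-cuts : Cuts∅ Good (⋃[ S ] (λ b → below b a)) × Covers G (bag a) (⋃[ S ] (λ b → below b a))
        below-cuts = join-all (Covers⇒Good (∣bag∣≤K a∈T)) (Covers-⊥ {bag a}) (Covers-∪ {bag a}) S _
          (λ i∈ j∈ v∈i v∈j → branch-unique isTree (children i∈) (children j∈)
            (proj₂ (below⁻ v∈i)) (proj₂ (below⁻ v∈j)))
          (λ b∈ → cuts b∈ , below-covers)

      below-cuts : ∀ {a p} → a ~ᵀ p → Cuts∅ Good (below a p)
      below-cuts = branch-induction isTree (λ a p → Cuts∅ Good (below a p)) λ {a} {p} a~p ih →
        let children = λ {b} b∈ → let b∈N , b≢p = x∈p-y⁻ {x = b} {y = p} (N T a) b∈ in ∈N⁻ T b∈N , b≢p in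
        subst (Cuts∅ Good) (union≡ a~p)
          (node-cuts (N T a - p) (~ᵀ⇒∈ a~p) (proj₁ ∘ children)
            (λ b∈ → ih (proj₁ (children b∈)) (proj₂ (children b∈))))
        where
        union≡ : ∀ {a p} → a ~ᵀ p → own a ∪ ⋃[ N T a - p ] (λ b → below b a) ≡ below a p
        union≡ {a} {p} a~p = ⊆-antisym (λ v∈ → to (x∈p∪q⁻ (own a) _ v∈))
          (λ v∈ → let v∈V , τ∈ = below⁻ v∈ in x∈p∪q⁺ (from v∈V (branch-unfold τ∈)))
          where
          to : ∀ {v} → v ∈ own a ⊎ v ∈ ⋃[ N T a - p ] (λ b → below b a) → v ∈ below a p
          to (inj₁ v∈) = let v∈V , τ≡a = own⁻ v∈ in
            below⁺ v∈V (subst (_∈ branch T a p) (sym τ≡a) (a∈branch a~p))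
          to (inj₂ v∈) =
            let b , b∈ , v∈b = ∈⋃⁻ (N T a - p) v∈
                b∈N , b≢p    = x∈p-y⁻ (N T a) b∈
                v∈V , τ∈     = below⁻ v∈b
            in below⁺ v∈V (branch-fold isTree a~p (∈N⁻ T b∈N) b≢p τ∈)
          from : ∀ {v} → v ∈ V G → τ v ≡ a ⊎ (∃ λ b → a ~ᵀ b × b ≢ p × τ v ∈ branch T b a) →
                 v ∈ own a ⊎ v ∈ ⋃[ N T a - p ] (λ b → below b a)
          from v∈V (inj₁ τ≡a) = inj₁ (own⁺ v∈V τ≡a)
          from v∈V (inj₂ (b , a~b , b≢p , τ∈)) =
            inj₂ (∈⋃⁺ (x∈p∧x≢y⇒x∈p-y (∈N⁺ T a~b) b≢p) (below⁺ v∈V τ∈))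

      all-cuts : Cuts∅ Good (V G)
      all-cuts = subst (Cuts∅ Good) (⊆-antisym (λ v∈ → to (x∈p∪q⁻ (own r) _ v∈))
          (λ v∈V → x∈p∪q⁺ (from v∈V (root-cover isTree r∈T τ∈T))))
        (node-cuts (N T r) r∈T (∈N⁻ T) (λ b∈ → below-cuts (~ᵀ-sym (∈N⁻ T b∈))))
        where
        to : ∀ {v} → v ∈ own r ⊎ v ∈ ⋃[ N T r ] (λ b → below b r) → v ∈ V G
        to (inj₁ v∈) = proj₁ (own⁻ v∈)
        to (inj₂ v∈) = let _ , _ , v∈b = ∈⋃⁻ (N T r) v∈ in proj₁ (below⁻ v∈b)
        from : ∀ {v} → v ∈ V G → τ v ≡ r ⊎ (∃ λ b → r ~ᵀ b × τ v ∈ branch T b r) →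
               v ∈ own r ⊎ v ∈ ⋃[ N T r ] (λ b → below b r)
        from v∈V (inj₁ τ≡r)           = inj₁ (own⁺ v∈V τ≡r)
        from v∈V (inj₂ (b , r~b , τ∈)) = inj₂ (∈⋃⁺ (∈N⁺ T r~b) (below⁺ v∈V τ∈))

-- Assembling the bound

empty-decomposition : {G : Graph n} → Empty (V G) → RankDecomposition G
empty-decomposition {G = G} V≡∅ = record
  -- A finite tree with a vertex has a leaf, so only the empty tree can be in bijection with no
  -- vertices.
  { tree      = tree
  ; isTree    = (λ { {()} }) , λ { (() , _) }
  ; maxDegree = λ { {()} }
  ; μ         = mk⤖ {to = λ v → contradiction v V≡∅}
    ((λ {v} → contradiction v V≡∅) , λ { (() , _) })
  }
  where
  tree : Graph 0
  tree = record { V = [] ; adj = λ () ; ~-sym = λ { {()} } ; ~-irrefl = λ { {()} } ; ~⇒∈ = λ { {()} } }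

cuts⇒rw : {G : Graph n} {w : ℕ} → Cuts∅ (BoundedCut G w) (V G) → rw[ G ]≤ + w
cuts⇒rw (inj₁ V≡∅) = _ , (empty-decomposition V≡∅ , refl) , ℤ.+≤+ z≤n
cuts⇒rw (inj₂ t)   = _ , (decomposition t , refl) , ℤ.+≤+ (decomposition-width t)

torso-cuts : (G : Graph n) (X : Subset n) (X⊆V : X ⊆ V G) (c : ℕ) → Torso G X X⊆V c →
             (D : TreeDecomposition (G ⊚ X)) → let open TreeDecomposition D in
             Cuts∅ (BoundedCut G (c ℕ.+ maxOver (V tree) (λ t → ∣ bag t ∣))) (V G)
torso-cuts {n} G X X⊆V c torso D = cuts (nonempty? (V tree))
  where
  open TreeDecomposition D using (tree; bag; coversV)

  K : ℕ
  K = maxOver (V tree) (λ t → ∣ bag t ∣)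

  cuts : Dec (Nonempty (V tree)) → Cuts∅ (BoundedCut G (c ℕ.+ K)) (V G)
  cuts (yes (r , r∈T)) = all-cuts G X X⊆V c K torso D (≤-maxOver (λ t → ∣ bag t ∣)) r∈T
  -- Without nodes the torso has no vertices, so all gates are empty and the empty set serves as the
  -- bag: G is the disjoint union of the components of G[X].
  cuts (no T≡∅)        = proj₁ (parts-cuts G X X⊆V c K torso {⊥}
    (≤-trans (≤-reflexive (∣⊥∣≡0 n)) z≤n) (V G) id (part-⊆V G X X⊆V)
    λ _ u∈ → let t , t∈T , _ = coversV (gate⊆ G X X⊆V u∈) in contradiction (t , t∈T) T≡∅)

lemma7 : ∀ (n c : ℕ) (G : Graph n) (k : ℤ) → 𝓡-Treewidth c G k → rw[ G ]≤ + c + k + 1ℤ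
lemma7 n c G _ ((X , (X⊆V , components) , (D , refl) , _) , _) =
  subst (rw[ G ]≤_) (sym bound≡)
    (cuts⇒rw (torso-cuts G X X⊆V c (record { components = components }) D))
  where
  open TreeDecomposition D using (tree; bag)
  open ≡-Reasoning

  K : ℕ
  K = maxOver (V tree) (λ t → ∣ bag t ∣)

  -- The final 1 restores the bag size from the treewidth `K` - 1; integers cover `K` = 0, where the
  -- treewidth is -1.
  bound≡ : + c + (+ K ℤ.- 1ℤ) + 1ℤ ≡ + (c ℕ.+ K)
  bound≡ = begin
    + c + (+ K ℤ.- 1ℤ) + 1ℤ  ≡⟨ ℤ.+-assoc (+ c) (+ K ℤ.- 1ℤ) 1ℤ ⟩
    + c + (+ K ℤ.- 1ℤ + 1ℤ)  ≡⟨ cong (λ z → + c + z) (ℤ.+-assoc (+ K) (ℤ.- 1ℤ) 1ℤ) ⟩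
    + c + (+ K + ℤ.0ℤ)       ≡⟨ cong (λ z → + c + z) (ℤ.+-identityʳ (+ K)) ⟩
    + (c ℕ.+ K)              ∎
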